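{- Let $n\ge1$ and let $\lambda$ be a partition with at most $n$ nonzero parts. The non-negative integer valued maps $\mathrm{zcount}$ and $\overline{\mathrm{zcount}}$ on $\mathrm{dg}(\lambda)\times\mathrm{CSF}(\lambda)$ satisfy the following properties: (1) For all $F\in\mathrm{CSF}(\lambda)$: $\sum_{c\in\mathrm{dg}(\lambda)}\mathrm{zcount}(c,F)=\mathrm{quinv}(F)$ and $\sum_{c\in\mathrm{dg}(\lambda)}\overline{\mathrm{zcount}}(c,F)=\mathrm{inv}(F)$. (2) If $F,F'\in\mathrm{CSF}(\lambda)$ with $\mathrm{rsort}(F)=\mathrm{rsort}(F')$, then for all $c\in\mathrm{dg}(\lambda)$: $$\mathrm{zcount}(c,F)+\overline{\mathrm{zcount}}(c,F)=\mathrm{zcount}(c,F')+\overline{\mathrm{zcount}}(c,F').$$ (3) Let $F\in\mathrm{CSF}(\lambda)$ and, for $v\in\{\mathrm{inv},\mathrm{quinv}\}$, let $\mathfrak b_v(F):=\mathrm{CL}(\psi_v(F))$ be the Chari-Loktev monomial of $\psi_v(F)\in\mathrm{POP}(\lambda)$. Then $$\mathfrak b_{\mathrm{quinv}}(F)=\prod_{c}^{\rightharpoonup}E_{F(c),\,i(c)}\otimes t^{\,\mathrm{zcount}(c,F)},\qquad \mathfrak b_{\mathrm{inv}}(F)=\prod_{c}^{\rightharpoonup}E_{F(c),\,i(c)}\otimes t^{\,\overline{\mathrm{zcount}}(c,F)},$$ where $i(c)$ denotes the row number in which $c$ occurs, the products are over the cells $c\in\mathrm{dg}(\lambda)$ with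 $F(c)>i(c)$, and $\prod^{\rightharpoonup}$ means that these cells are enumerated in weakly increasing order of $F(c)$ (any such enumeration gives the same final value in the products).
   Context: The Young diagram of $\lambda$ is $\mathrm{dg}(\lambda)=\{(r,c):1\le c\le\lambda_r\}$, with $r$ the row index from the top and $c$ the column index from the left. $\mathrm{CSF}(\lambda)$ is the set of column strict fillings: maps $F:\mathrm{dg}(\lambda)\to[n]=\{1,\dots,n\}$ strictly increasing down each column. Statistics. For a cell $u=(i,j)$ with $i>1$ let $u^\uparrow=(i-1,j)$; $\mathrm{Des}(F)$ is the set of cells $u$ not in the first row with $F(u)>F(u^\uparrow)$; $\mathrm{arm}(u)$ is the number of cells of $\mathrm{dg}(\lambda)$ strictly to the right of $u$ in its row. A cell $u$ Inv-attacks $v$ if they are in the same row with $u$ strictly left of $v$, or $u$ is in the row immediately below that of $v$, in a column strictly to the right of that of $v$. A cell $u$ Quinv-attacks $v$ if they are in the same row with $u$ strictly right of $v$, or $u$ is in the row immediately below that of $v$, in a column strictly to the left of that of $v$. $\mathrm{Inv}(F)$ (resp. $\mathrm{Quinv}(F)$) is the set of pairs $(u,v)$ such that $u$ Inv-attacks (resp. Quinv-attacks) $v$ and $F(u)>F(v)$. Then $\mathrm{inv}(F)=|\mathrm{Inv}(F)|-\sum_{u\in\mathrm{Des}(F)}\mathrm{arm}(u)$ and $\mathrm{quinv}(F)=|\mathrm{Quinv}(F)|-\sum_{u\in\mathrm{Des}(F)}\mathrm{arm}(u^\uparrow)$. zcounts. For $F\in\mathrm{CSF}(\lambda)$ and a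 cell $c\in\mathrm{dg}(\lambda)$, $\mathrm{zcount}(c,F)$ (resp. $\overline{\mathrm{zcount}}(c,F)$) is the number of cells $x$ in the row of $c$, strictly to the left (resp. strictly to the right) of $c$, such that $F(x)<F(c)<F(y)$, where $y$ is the position immediately below $x$ and $F(y):=\infty$ if $y\notin\mathrm{dg}(\lambda)$. Patterns. $\mathrm{GT}(\lambda)$ is the set of integer arrays $T=(T^j_i:1\le i\le j\le n)$ with $T^n_i=\lambda_i$ and, for $1\le i\le j<n$, $\mathrm{NE}_{ij}(T):=T^{j+1}_i-T^j_i\ge0$ and $\mathrm{SE}_{ij}(T):=T^j_i-T^{j+1}_{i+1}\ge0$; it is identified with semistandard Young tableaux of shape $\lambda$ with entries in $[n]$ by letting $T^j_i$ be the number of cells in row $i$ with entries $\le j$. $\mathrm{rsort}(F)$ is obtained from $F$ by sorting the entries of each row in ascending order from left to right; it is a semistandard tableau, regarded as an element of $\mathrm{GT}(\lambda)$. $\mathrm{POP}(\lambda)$ is the set of pairs $(T,\Lambda)$ with $T\in\mathrm{GT}(\lambda)$ and $\Lambda=(\Lambda_{ij}:1\le i\le j<n)$ a tuple of partitions, $\Lambda_{ij}$ having at most $\mathrm{NE}_{ij}(T)$ nonzero parts, each $\le\mathrm{SE}_{ij}(T)$. The maps $\psi_v:\mathrm{CSF}(\lambda)\to\mathrm{POP}(\lambda)$. For $1\le i\le j<n$ let $\mathrm{cells}(i,j,F)$ be the set of cells $c$ in row $i$ with $F(c)=j+1$. Put $T=\mathrm{rsort}(F)$. Let $\Lambda_{ij}$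 be the sequence of $\mathrm{zcount}(c,F)$, $c\in\mathrm{cells}(i,j,F)$, read from right to left in row $i$, and $\overline\Lambda_{ij}$ the sequence of $\overline{\mathrm{zcount}}(c,F)$, $c\in\mathrm{cells}(i,j,F)$, read from left to right. These are partitions fitting in the $\mathrm{NE}_{ij}(T)\times\mathrm{SE}_{ij}(T)$ rectangle; $\psi_{\mathrm{quinv}}(F)=(T,(\Lambda_{ij}))$ and $\psi_{\mathrm{inv}}(F)=(T,(\overline\Lambda_{ij}))$. Chari-Loktev monomials. Let $\mathfrak n^-$ be the Lie algebra of strictly lower triangular $n\times n$ complex matrices, $E_{pq}$ ($n\ge p>q\ge1$) the elementary matrix with a $1$ in position $(p,q)$, $\mathfrak n^-[t]=\mathfrak n^-\otimes\mathbb C[t]$, and $\mathfrak U\mathfrak n^-[t]$ its universal enveloping algebra. For $\mathfrak P=(T,\Lambda)\in\mathrm{POP}(\lambda)$ and $1\le i\le j<n$, write $\Lambda_{ij}=(\Lambda_{ij}(1)\ge\dots\ge\Lambda_{ij}(k)\ge0)$ with $k=\mathrm{NE}_{ij}(T)$ (zero parts included), and set $\mathbb L_{ij}(\mathfrak P)=\prod_{m=1}^{k}(E_{j+1,i}\otimes t^{\Lambda_{ij}(m)})$, $\mathbb L_j(\mathfrak P)=\prod_{i=1}^j\mathbb L_{ij}(\mathfrak P)$ (in these products the factors commute), and $\mathrm{CL}(\mathfrak P)=\mathbb L_1(\mathfrak P)\mathbb L_2(\mathfrak P)\cdots\mathbb L_{n-1}(\mathfrak P)\in\mathfrak U\mathfrak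 n^-[t]$.
   Formalization: Part (2) is false for the same position c (n=2, λ=(2,0), F=[1 2], F'=[2 1], first cell: 0 versus 1); it is proved instead for cells c of F and c' of F' in the same row with F(c)=F'(c'). -}

module Defs where

open import Algebra using (AbelianGroup; CommutativeMonoid; CommutativeRing; Ring)
open import Algebra.Core using (Op₂)
open import Algebra.Module.Bundles using (LeftModule)
import Algebra.Properties.AbelianGroup as AbelianGroupProperties
import Algebra.Properties.CommutativeSemigroup as CommutativeSemigroupProperties
import Algebra.Properties.Group as GroupProperties
import Algebra.Properties.Ring as RingProperties
import Algebra.Properties.Semiring.Sum as Sum
open import Data.Empty using (⊥)
open import Data.Fin as Fin using (Fin; zero; suc; toℕ; fromℕ; fromℕ<; inject₁; inject!; inject≤; Fin′)
open import Data.Fin.Properties as Fin using (toℕ-inject₁; toℕ-inject≤; toℕ<n; inject!-<; ≤̄⇒inject₁<; fromℕ<-toℕ; ≤fromℕ)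
open import Data.Integer as ℤ using (ℤ; +_; 0ℤ)
import Data.Integer.Properties as ℤ
open import Data.List as List using (List; []; _∷_; length; map; filter; reverse; concatMap; cartesianProduct; allFin; tabulate; foldr)
open import Data.List.Properties as List using (unfold-reverse)
open import Data.List.Relation.Binary.Permutation.Propositional using (_↭_; ↭-sym)
open import Data.List.Relation.Binary.Permutation.Propositional.Properties using (All-resp-↭; ↭-length; filter-↭; ↭-reverse)
open import Data.List.Relation.Unary.All as All using (All; []; _∷_)
import Data.List.Relation.Unary.All.Properties as All
open import Data.List.Relation.Unary.AllPairs as AllPairs using (AllPairs; []; _∷_)
import Data.List.Relation.Unary.AllPairs.Properties as AllPairs
import Data.List.Relation.Unary.Sorted.TotalOrder.Properties as Sorted
import Data.List.Sort as Sort
open import Data.Maybe as Maybe using (Maybe; just; nothing)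
open import Data.Nat as ℕ using (ℕ; zero; suc; z≤n; s≤s; s≤s⁻¹)
open import Data.Nat.ListAction using (sum)
import Data.Nat.Properties as ℕ
open import Data.Product using (Σ-syntax; _×_; _,_; proj₁; proj₂)
open import Data.Sum using (_⊎_; inj₁; inj₂)
open import Function using (_∘_; id)
open import Level using (Level; _⊔_) renaming (suc to lsuc)
open import Relation.Binary.Bundles using (DecTotalOrder)
import Relation.Binary.Construct.Add.Supremum.Strict as Supremum
import Relation.Binary.Construct.On as On
open import Relation.Binary.PropositionalEquality as ≡ using (_≡_)
open import Relation.Nullary using (Dec; yes; no; ¬_; _×-dec_; _⊎-dec_; contradiction; contradiction-irr)
open import Relation.Nullary.Construct.Add.Supremum using (_⁺) renaming ([_] to finite)
open import Relation.Unary using (Pred; Decidable)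

private
  variable
    a p q r : Level
    A : Set a
    k l m n : ℕ

count : {P : Pred A p} → Decidable P → List A → ℕ
count P? xs = length (filter P? xs)

module _ {P : Pred A p} {Q : Pred A q} (P? : Decidable P) (Q? : Decidable Q) where

  count-mono : ∀ xs → All (λ x → P x → Q x) xs → count P? xs ℕ.≤ count Q? xs
  count-mono [] [] = z≤n
  count-mono (x ∷ xs) (px ∷ pxs) with P? x | Q? x
  ... | yes _ | yes _ = s≤s (count-mono xs pxs)
  ... | yes x∈P | no x∉Q = contradiction (px x∈P) x∉Q
  ... | no _ | yes _ = ℕ.m≤n⇒m≤1+n (count-mono xs pxs)
  ... | no _ | no _ = count-mono xs pxs

count-split : {P : Pred A p} {Q : Pred A q} {R : Pred A r}
  (P? : Decidable P) (Q? : Decidable Q) (R? : Decidable R) →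
  (∀ x → P x → Q x) → (∀ x → R x → Q x) → (∀ x → P x → ¬ R x) → (∀ x → Q x → P x ⊎ R x) →
  ∀ xs → count P? xs ℕ.+ count R? xs ≡ count Q? xs
count-split P? Q? R? P⇒Q R⇒Q P⇒¬R Q⇒ [] = ≡.refl
count-split P? Q? R? P⇒Q R⇒Q P⇒¬R Q⇒ (x ∷ xs)
  with ih ← count-split P? Q? R? P⇒Q R⇒Q P⇒¬R Q⇒ xs | P? x | Q? x | R? x
... | yes x∈P | yes _ | yes x∈R = contradiction x∈R (P⇒¬R x x∈P)
... | yes _ | yes _ | no _ = ≡.cong suc ih
... | no _ | yes _ | yes _ = ≡.trans (ℕ.+-suc _ _) (≡.cong suc ih)
... | no _ | no _ | no _ = ih
... | yes x∈P | no x∉Q | _ = contradiction (P⇒Q x x∈P) x∉Q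
... | no _ | no x∉Q | yes x∈R = contradiction (R⇒Q x x∈R) x∉Q
... | no x∉P | yes x∈Q | no x∉R with Q⇒ x x∈Q
...   | inj₁ x∈P = contradiction x∈P x∉P
...   | inj₂ x∈R = contradiction x∈R x∉R

-- For f embedding a shorter row into the start of a longer one.
count-disjoint : {B : Set a} {P : Pred A p} {Q : Pred B q} {R : Pred B r}
  (P? : Decidable P) (Q? : Decidable Q) (R? : Decidable R) (k≤l : k ℕ.≤ l)
  (f : Fin k → A) (g : Fin l → B) →
  (∀ x → R (g x) → Q (g x)) →
  (∀ x → P (f x) → Q (g (inject≤ x k≤l))) →
  (∀ x → P (f x) → ¬ R (g (inject≤ x k≤l))) →
  count R? (tabulate g) ℕ.+ count P? (tabulate f) ℕ.≤ count Q? (tabulate g)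
count-disjoint P? Q? R? z≤n f g R⇒Q P⇒Q P⇒¬R
  rewrite ℕ.+-identityʳ (count R? (tabulate g)) = count-mono R? Q? (tabulate g) (All.tabulate⁺ R⇒Q)
count-disjoint P? Q? R? (s≤s k≤l) f g R⇒Q P⇒Q P⇒¬R
  with ih ← count-disjoint P? Q? R? k≤l (f ∘ suc) (g ∘ suc) (R⇒Q ∘ suc) (P⇒Q ∘ suc) (P⇒¬R ∘ suc)
     | P? (f zero) | R? (g zero) | Q? (g zero)
... | yes x∈P | yes x∈R | _ = contradiction x∈R (P⇒¬R zero x∈P)
... | yes x∈P | no _ | no x∉Q = contradiction (P⇒Q zero x∈P) x∉Q
... | no _ | yes x∈R | no x∉Q = contradiction (R⇒Q zero x∈R) x∉Q
... | yes _ | no _ | yes _ = ℕ.≤-trans (ℕ.≤-reflexive (ℕ.+-suc _ _)) (s≤s ih)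
... | no _ | yes _ | yes _ = s≤s ih
... | no _ | no _ | yes _ = ℕ.m≤n⇒m≤1+n ih
... | no _ | no _ | no _ = ih

count-tabulate : {B : Set a} {P : Pred B p} (P? : Decidable P) (g : A → B) (h : Fin n → A) →
  count P? (tabulate (λ i → g (h i))) ≡ count (λ x → P? (g x)) (tabulate h)
count-tabulate {n = zero} P? g h = ≡.refl
count-tabulate {n = suc n} P? g h with P? (g (h zero))
... | yes _ = ≡.cong suc (count-tabulate P? g (h ∘ suc))
... | no _ = count-tabulate P? g (h ∘ suc)

-- Rows and columns are numbered from 0, and so are the entries of fillings:
-- the letter v of [n] is the element v - 1 of Fin n.

record Partition (n : ℕ) : Set where
  field
    part : Fin n → ℕ
    decreasing : ∀ {i j} → i Fin.≤ j → part j ℕ.≤ part i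

open Partition public

record Cell (μ : Partition n) : Set where
  constructor _,_
  field
    row : Fin n
    column : Fin (part μ row)

  col : ℕ
  col = toℕ column

open Cell public

cells : (μ : Partition n) → List (Cell μ)
cells {n} μ = concatMap (λ r → map (r ,_) (allFin (part μ r))) (allFin n)

record CSF (μ : Partition n) : Set where
  field
    entry : Cell μ → Fin n
    column-strict : ∀ {u v} → col u ≡ col v → row u Fin.< row v → entry u Fin.< entry v

open CSF public

-- The value on first-row cells is junk.
above : {μ : Partition n} → Cell μ → Cell μ
above (zero , c) = zero , c
above {μ = μ} (suc r , c) =
  inject₁ r , inject≤ c (decreasing μ (ℕ.<⇒≤ (≤̄⇒inject₁< {i = r} ℕ.≤-refl)))

cellInRow : (μ : Partition n) → Fin n → ℕ → Maybe (Cell μ)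
cellInRow μ r j with j ℕ.<? part μ r
... | no _ = nothing
... | yes j<μᵣ = just (r , fromℕ< j<μᵣ)

cellAt : (μ : Partition n) → ℕ → ℕ → Maybe (Cell μ)
cellAt {n} μ i j with i ℕ.<? n
... | no _ = nothing
... | yes i<n = cellInRow μ (fromℕ< i<n) j

module _ {μ : Partition n} where

  arm : Cell μ → ℕ
  arm u = count (λ v → (row v Fin.≟ row u) ×-dec (col u ℕ.<? col v)) (cells μ)

  InvAttacks QuinvAttacks : Cell μ → Cell μ → Set
  InvAttacks u v =
    (row u ≡ row v × col u ℕ.< col v) ⊎
    (toℕ (row u) ≡ suc (toℕ (row v)) × col v ℕ.< col u)
  QuinvAttacks u v =
    (row u ≡ row v × col v ℕ.< col u) ⊎
    (toℕ (row u) ≡ suc (toℕ (row v)) × col u ℕ.< col v)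

  invAttacks? : ∀ u v → Dec (InvAttacks u v)
  invAttacks? u v =
    ((row u Fin.≟ row v) ×-dec (col u ℕ.<? col v)) ⊎-dec
    ((toℕ (row u) ℕ.≟ suc (toℕ (row v))) ×-dec (col v ℕ.<? col u))

  quinvAttacks? : ∀ u v → Dec (QuinvAttacks u v)
  quinvAttacks? u v =
    ((row u Fin.≟ row v) ×-dec (col v ℕ.<? col u)) ⊎-dec
    ((toℕ (row u) ℕ.≟ suc (toℕ (row v))) ×-dec (col u ℕ.<? col v))

  Des : CSF μ → List (Cell μ)
  Des F = filter (λ u → (0 ℕ.<? toℕ (row u)) ×-dec (entry F (above u) Fin.<? entry F u)) (cells μ)

  Inv Quinv : CSF μ → List (Cell μ × Cell μ)
  Inv F = filter (λ (u , v) → invAttacks? u v ×-dec (entry F v Fin.<? entry F u))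
                 (cartesianProduct (cells μ) (cells μ))
  Quinv F = filter (λ (u , v) → quinvAttacks? u v ×-dec (entry F v Fin.<? entry F u))
                   (cartesianProduct (cells μ) (cells μ))

  inv quinv : CSF μ → ℤ
  inv F = + length (Inv F) ℤ.- + sum (map arm (Des F))
  quinv F = + length (Quinv F) ℤ.- + sum (map (arm ∘ above) (Des F))

  -- A ⁺ is Maybe A, with nothing as the largest element ∞.
  entryBelow : CSF μ → Cell μ → Fin n ⁺
  entryBelow F x = Maybe.map (entry F) (cellAt μ (suc (toℕ (row x))) (col x))

  open Supremum (Fin._<_ {n} {n}) using (_<⁺_; <⁺-dec)

  Between : CSF μ → Cell μ → Cell μ → Set
  Between F c x = (entry F x Fin.< entry F c) × (finite (entry F c) <⁺ entryBelow F x)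

  between? : ∀ F c x → Dec (Between F c x)
  between? F c x = (entry F x Fin.<? entry F c) ×-dec <⁺-dec Fin._<?_ (finite (entry F c)) (entryBelow F x)

  zcount zcount-bar : Cell μ → CSF μ → ℕ
  zcount (r , c) F =
    count (λ x → (x Fin.<? c) ×-dec between? F (r , c) (r , x)) (allFin (part μ r))
  zcount-bar (r , c) F =
    count (λ x → (c Fin.<? x) ×-dec between? F (r , c) (r , x)) (allFin (part μ r))

  -- The tableau rsort F is given by the lists of entries of its rows.
  rsort : CSF μ → Fin n → List (Fin n)
  rsort F r = Sort.sort (Fin.≤-decTotalOrder n) (tabulate (λ c → entry F (r , c)))

-- Gelfand–Tsetlin patterns for n = suc m. Superscripts j and subscripts i are
-- 0-based too, so T j i stands for T^{j+1}_{i+1} in the usual numbering. The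
-- superscripts j < n of NE and SE range over Fin m, so that inject₁ j and suc j
-- are consecutive superscripts of T.

module _ {i j : Fin m} where

  inject₁-mono : i Fin.≤ j → inject₁ i Fin.≤ inject₁ j
  inject₁-mono i≤j rewrite toℕ-inject₁ i | toℕ-inject₁ j = i≤j

  inject₁≤suc : i Fin.≤ j → inject₁ i Fin.≤ suc j
  inject₁≤suc i≤j = ℕ.<⇒≤ (≤̄⇒inject₁< i≤j)

Triangle : ℕ → Set
Triangle n = (j i : Fin n) → .(i Fin.≤ j) → ℤ

NE SE : Triangle (suc m) → (i j : Fin m) → .(i Fin.≤ j) → ℤ
NE T i j i≤j =
  T (suc j) (inject₁ i) (inject₁≤suc i≤j) ℤ.- T (inject₁ j) (inject₁ i) (inject₁-mono i≤j)
SE T i j i≤j =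
  T (inject₁ j) (inject₁ i) (inject₁-mono i≤j) ℤ.- T (suc j) (suc i) (s≤s i≤j)

record GT (μ : Partition (suc m)) : Set where
  field
    T : Triangle (suc m)
    top : ∀ i → T (fromℕ m) i (≤fromℕ i) ≡ + part μ i
    NE≥0 : ∀ i j .(i≤j : i Fin.≤ j) → 0ℤ ℤ.≤ NE T i j i≤j
    SE≥0 : ∀ i j .(i≤j : i Fin.≤ j) → 0ℤ ℤ.≤ SE T i j i≤j

open GT public

-- Partitions with at most h nonzero parts, each at most w, as sequences of
-- exactly h parts (zero parts included).
record BoxPartition (h w : ℤ) : Set where
  field
    parts : List ℕ
    length≡h : + length parts ≡ h
    weakly-decreasing : AllPairs ℕ._≥_ parts
    bounded : All (λ x → + x ℤ.≤ w) parts

open BoxPartition public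

record POP (μ : Partition (suc m)) : Set where
  field
    gt : GT μ
    Λ : (i j : Fin m) .(i≤j : i Fin.≤ j) → BoxPartition (NE (T gt) i j i≤j) (SE (T gt) i j i≤j)

open POP public

module _ {μ : Partition (suc m)} where

  -- The identification of tableaux with patterns, applied to rsort F.
  rsortPattern : CSF μ → Triangle (suc m)
  rsortPattern F j i _ = + count (λ v → v Fin.≤? j) (rsort F i)

  -- The columns of cells(i,j,F), from left to right.
  cellsWith : CSF μ → (i j : Fin m) → List (Fin (part μ (inject₁ i)))
  cellsWith F i j = filter (λ c → entry F (inject₁ i , c) Fin.≟ suc j) (allFin _)

module _ {μ : Partition (suc m)} (F : CSF μ) where

  open Supremum (Fin._<_ {suc m} {suc m}) using (_<⁺_; [<]-injective)

  cellInRow-toℕ : ∀ r (c : Fin (part μ r)) → cellInRow μ r (toℕ c) ≡ just (r , c)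
  cellInRow-toℕ r c with toℕ c ℕ.<? part μ r
  ... | no c≮μᵣ = contradiction (toℕ<n c) c≮μᵣ
  ... | yes c<μᵣ = ≡.cong (λ d → just (r , d)) (fromℕ<-toℕ c c<μᵣ)

  cellAt-toℕ : (u : Cell μ) → cellAt μ (toℕ (row u)) (col u) ≡ just u
  cellAt-toℕ (r , c) with toℕ r ℕ.<? suc m
  ... | no r≮n = contradiction (toℕ<n r) r≮n
  ... | yes r<n =
    ≡.trans (≡.cong (λ s → cellInRow μ s (toℕ c)) (fromℕ<-toℕ r r<n)) (cellInRow-toℕ r c)

  shorter : ∀ i → part μ (suc i) ℕ.≤ part μ (inject₁ i)
  shorter i = decreasing μ (inject₁≤suc {i = i} ℕ.≤-refl)

  below-inject : ∀ i (y : Fin (part μ (suc i))) →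
    entryBelow F (inject₁ i , inject≤ y (shorter i)) ≡ finite (entry F (suc i , y))
  below-inject i y = ≡.cong (Maybe.map (entry F)) (≡.trans
    (≡.cong₂ (cellAt μ) (≡.cong suc (toℕ-inject₁ i)) (toℕ-inject≤ y (shorter i)))
    (cellAt-toℕ (suc i , y)))

  count-rsort : (j i : Fin (suc m)) →
    count (λ v → v Fin.≤? j) (rsort F i) ≡ count (λ c → entry F (i , c) Fin.≤? j) (allFin (part μ i))
  count-rsort j i = ≡.trans
    (↭-length (filter-↭ (λ v → v Fin.≤? j) (Sort.sort-↭ (Fin.≤-decTotalOrder (suc m)) _)))
    (count-tabulate (λ v → v Fin.≤? j) (λ c → entry F (i , c)) id)

  NE-count : ∀ i j .(i≤j : i Fin.≤ j) →
    + length (cellsWith F i j) ≡ NE (rsortPattern F) i j i≤j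
  NE-count i j i≤j = ≡.trans (≡.sym (cancel old _))
    (≡.cong₂ (λ x y → + x ℤ.- + y)
      (≡.trans split (≡.sym (count-rsort (suc j) (inject₁ i))))
      (≡.sym (count-rsort (inject₁ j) (inject₁ i))))
    where
    old = count (λ c → entry F (inject₁ i , c) Fin.≤? inject₁ j) (allFin (part μ (inject₁ i)))

    cancel : ∀ x y → + (x ℕ.+ y) ℤ.- + x ≡ + y
    cancel x y = ≡.trans (ℤ.m-n≡m⊖n (x ℕ.+ y) x) (≡.trans (ℤ.⊖-≥ (ℕ.m≤m+n x y)) (≡.cong +_ (ℕ.m+n∸m≡n x y)))

    old⇒new : ∀ {v : Fin (suc m)} → v Fin.≤ inject₁ j → v Fin.≤ suc j
    old⇒new v≤j rewrite toℕ-inject₁ j = ℕ.m≤n⇒m≤1+n v≤j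

    split = count-split
      (λ c → entry F (inject₁ i , c) Fin.≤? inject₁ j)
      (λ c → entry F (inject₁ i , c) Fin.≤? suc j)
      (λ c → entry F (inject₁ i , c) Fin.≟ suc j)
      (λ _ → old⇒new)
      (λ _ → Fin.≤-reflexive)
      (λ c v≤j v≡ → ℕ.1+n≰n (≡.subst (suc (toℕ j) ℕ.≤_) (toℕ-inject₁ j) (≡.subst (Fin._≤ inject₁ j) v≡ v≤j)))
      (λ c v≤ → case-≤ v≤)
      (allFin (part μ (inject₁ i)))
      where
      case-≤ : ∀ {v : Fin (suc m)} → v Fin.≤ suc j → v Fin.≤ inject₁ j ⊎ v ≡ suc j
      case-≤ {v} v≤ with v Fin.≟ suc j
      ... | yes v≡ = inj₂ v≡
      ... | no v≢ = inj₁ (≡.subst (toℕ v ℕ.≤_) (≡.sym (toℕ-inject₁ j)) (s≤s⁻¹ (Fin.≤∧≢⇒< v≤ v≢)))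

  SE-count : ∀ i j .(i≤j : i Fin.≤ j) {R : Pred (Fin (part μ (inject₁ i))) r} (R? : Decidable R) →
    (∀ x → R x → entry F (inject₁ i , x) Fin.< suc j × finite (suc j) <⁺ entryBelow F (inject₁ i , x)) →
    + count R? (allFin _) ℤ.≤ SE (rsortPattern F) i j i≤j
  SE-count i j i≤j R? R⇒ = ℤ.≤-trans
    (ℤ.≤-reflexive (≡.sym (≡.trans (ℤ.m-n≡m⊖n (z ℕ.+ lower) lower)
      (≡.trans (ℤ.⊖-≥ (ℕ.m≤n+m lower z)) (≡.cong +_ (ℕ.m+n∸n≡m z lower))))))
    (ℤ.≤-trans (ℤ.+-monoˡ-≤ (ℤ.- + lower) (ℤ.+≤+ le))
      (ℤ.≤-reflexive (≡.cong₂ (λ x y → + x ℤ.- + y)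
        (≡.sym (count-rsort (inject₁ j) (inject₁ i)))
        (≡.sym (count-rsort (suc j) (suc i))))))
    where
    z = count R? (allFin (part μ (inject₁ i)))
    lower = count (λ y → entry F (suc i , y) Fin.≤? suc j) (allFin (part μ (suc i)))

    <⇒≤ : ∀ {v : Fin (suc m)} → v Fin.< suc j → v Fin.≤ inject₁ j
    <⇒≤ {v} v< = ≡.subst (toℕ v ℕ.≤_) (≡.sym (toℕ-inject₁ j)) (s≤s⁻¹ v<)

    le = count-disjoint
      (λ y → entry F (suc i , y) Fin.≤? suc j)
      (λ x → entry F (inject₁ i , x) Fin.≤? inject₁ j)
      R? (shorter i) id id
      (λ x Rx → <⇒≤ (proj₁ (R⇒ x Rx)))
      (λ y v≤ → <⇒≤ (ℕ.<-≤-trans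
        (column-strict F (toℕ-inject≤ y (shorter i)) (≤̄⇒inject₁< {i = i} ℕ.≤-refl)) v≤))
      (λ y v≤ Ry → ℕ.<⇒≱
        ([<]-injective (≡.subst (finite (suc j) <⁺_) (below-inject i y) (proj₂ (R⇒ _ Ry)))) v≤)

  cellsWith-entries : ∀ i j → All (λ c → entry F (inject₁ i , c) ≡ suc j) (cellsWith F i j)
  cellsWith-entries i j = All.all-filter _ (allFin _)

  cellsWith-increasing : ∀ i j → AllPairs
    (λ c d → c Fin.< d × entry F (inject₁ i , c) ≡ entry F (inject₁ i , d)) (cellsWith F i j)
  cellsWith-increasing i j = zip
    (AllPairs.filter⁺ (λ c → entry F (inject₁ i , c) Fin.≟ suc j) (AllPairs.tabulate⁺-< id))
    (cellsWith-entries i j)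
    where
    zip : ∀ {cs : List (Fin (part μ (inject₁ i)))} → AllPairs Fin._<_ cs →
      All (λ c → entry F (inject₁ i , c) ≡ suc j) cs →
      AllPairs (λ c d → c Fin.< d × entry F (inject₁ i , c) ≡ entry F (inject₁ i , d)) cs
    zip [] [] = []
    zip (c<cs ∷ cs<) (p ∷ ps) = All.zipWith (λ (c<d , q) → c<d , ≡.trans p (≡.sym q)) (c<cs , ps) ∷ zip cs< ps

  zcount-mono : ∀ r {c d : Fin (part μ r)} → c Fin.< d → entry F (r , c) ≡ entry F (r , d) →
    zcount (r , c) F ℕ.≤ zcount (r , d) F
  zcount-mono r {c} {d} c<d eq =
    count-mono (λ x → (x Fin.<? c) ×-dec between? F (r , c) (r , x))
               (λ x → (x Fin.<? d) ×-dec between? F (r , d) (r , x)) (allFin _)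
      (All.universal
        (λ x (x<c , x↑ , x↓) → ℕ.<-trans x<c c<d , ≡.subst (entry F (r , x) Fin.<_) eq x↑ ,
          ≡.subst (λ v → finite v <⁺ entryBelow F (r , x)) eq x↓) _)

  zcount-bar-mono : ∀ r {c d : Fin (part μ r)} → c Fin.< d → entry F (r , c) ≡ entry F (r , d) →
    zcount-bar (r , d) F ℕ.≤ zcount-bar (r , c) F
  zcount-bar-mono r {c} {d} c<d eq =
    count-mono (λ x → (d Fin.<? x) ×-dec between? F (r , d) (r , x))
               (λ x → (c Fin.<? x) ×-dec between? F (r , c) (r , x)) (allFin _)
      (All.universal
        (λ x (d<x , x↑ , x↓) → ℕ.<-trans c<d d<x , ≡.subst (entry F (r , x) Fin.<_) (≡.sym eq) x↑ ,
          ≡.subst (λ v → finite v <⁺ entryBelow F (r , x)) (≡.sym eq) x↓) _)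

  zcount-bounded : ∀ i j .(i≤j : i Fin.≤ j) {c} → entry F (inject₁ i , c) ≡ suc j →
    + zcount (inject₁ i , c) F ℤ.≤ SE (rsortPattern F) i j i≤j
  zcount-bounded i j i≤j {c} eq = SE-count i j i≤j
    (λ x → (x Fin.<? c) ×-dec between? F (inject₁ i , c) (inject₁ i , x))
    (λ x (_ , x↑ , x↓) → ≡.subst (entry F (inject₁ i , x) Fin.<_) eq x↑ ,
      ≡.subst (λ v → finite v <⁺ entryBelow F (inject₁ i , x)) eq x↓)

  zcount-bar-bounded : ∀ i j .(i≤j : i Fin.≤ j) {c} → entry F (inject₁ i , c) ≡ suc j →
    + zcount-bar (inject₁ i , c) F ℤ.≤ SE (rsortPattern F) i j i≤j
  zcount-bar-bounded i j i≤j {c} eq = SE-count i j i≤j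
    (λ x → (c Fin.<? x) ×-dec between? F (inject₁ i , c) (inject₁ i , x))
    (λ x (_ , x↑ , x↓) → ≡.subst (entry F (inject₁ i , x) Fin.<_) eq x↑ ,
      ≡.subst (λ v → finite v <⁺ entryBelow F (inject₁ i , x)) eq x↓)

reverse⁺ : {R : A → A → Set r} {xs : List A} → AllPairs R xs → AllPairs (λ x y → R y x) (reverse xs)
reverse⁺ [] = []
reverse⁺ {xs = x ∷ xs} (px ∷ pxs) rewrite unfold-reverse x xs =
  AllPairs.++⁺ (reverse⁺ pxs) ([] ∷ [])
    (All.map (_∷ []) (All-resp-↭ (↭-sym (↭-reverse xs)) px))

module _ {μ : Partition (suc m)} where

  rsortGT : CSF μ → GT μ
  rsortGT F = record
    { T = rsortPattern F
    ; top = λ i → ≡.cong +_ (≡.trans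
        (≡.cong length (List.filter-all (λ v → v Fin.≤? fromℕ m) (All.universal ≤fromℕ (rsort F i))))
        (≡.trans (↭-length (Sort.sort-↭ (Fin.≤-decTotalOrder (suc m)) _))
               (List.length-tabulate (λ c → entry F (i , c)))))
    ; NE≥0 = λ i j i≤j → ≡.subst (0ℤ ℤ.≤_) (NE-count F i j i≤j) (ℤ.+≤+ z≤n)
    ; SE≥0 = λ i j i≤j → ℤ.≤-trans (ℤ.+≤+ z≤n) (SE-count F i j i≤j {R = λ _ → ⊥} (λ _ → no id) (λ _ ()))
    }

  ψ-quinv ψ-inv : CSF μ → POP μ
  ψ-quinv F = record
    { gt = rsortGT F
    ; Λ = λ i j i≤j → record
      { parts = map (λ c → zcount (inject₁ i , c) F) (reverse (cellsWith F i j))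
      ; length≡h = ≡.trans
          (≡.cong +_ (≡.trans (List.length-map _ (reverse (cellsWith F i j))) (List.length-reverse (cellsWith F i j))))
          (NE-count F i j i≤j)
      ; weakly-decreasing = AllPairs.map⁺ (reverse⁺
          (AllPairs.map (λ (c<d , eq) → zcount-mono F _ c<d eq) (cellsWith-increasing F i j)))
      ; bounded = All.map⁺ (All-resp-↭ (↭-sym (↭-reverse (cellsWith F i j)))
          (All.map (λ eq → zcount-bounded F i j i≤j eq) (cellsWith-entries F i j)))
      }
    }
  ψ-inv F = record
    { gt = rsortGT F
    ; Λ = λ i j i≤j → record
      { parts = map (λ c → zcount-bar (inject₁ i , c) F) (cellsWith F i j)
      ; length≡h = ≡.trans (≡.cong +_ (List.length-map _ (cellsWith F i j))) (NE-count F i j i≤j)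
      ; weakly-decreasing = AllPairs.map⁺
          (AllPairs.map (λ (c<d , eq) → zcount-bar-mono F _ c<d eq) (cellsWith-increasing F i j))
      ; bounded = All.map⁺
          (All.map (λ eq → zcount-bar-bounded F i j i≤j eq) (cellsWith-entries F i j))
      }
    }

module _ {μ : Partition n} (F : CSF μ) where

  -- The enumerations over which the ordered products run.
  record IncreasingEnumeration : Set where
    field
      enumeration : List (Cell μ)
      permutes : enumeration ↭ filter (λ c → row c Fin.<? entry F c) (cells μ)
      increasing : AllPairs (λ c d → entry F c Fin.≤ entry F d) enumeration

    row<entry : All (λ c → row c Fin.< entry F c) enumeration
    row<entry = All-resp-↭ (↭-sym permutes) (All.all-filter _ (cells μ))

  increasingEnumeration : IncreasingEnumeration
  increasingEnumeration = record
    { enumeration = sort cs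
    ; permutes = sort-↭ cs
    ; increasing = Sorted.Sorted⇒AllPairs (DecTotalOrder.totalOrder byEntry) (sort-↗ cs)
    }
    where
    byEntry = On.decTotalOrder (Fin.≤-decTotalOrder n) (entry F)
    open Sort byEntry using (sort; sort-↭; sort-↗)
    cs = filter (λ c → row c Fin.<? entry F c) (cells μ)

open IncreasingEnumeration public

record LieAlgebra {a ℓ} (K : CommutativeRing a ℓ) c ℓᶜ : Set (a ⊔ ℓ ⊔ lsuc (c ⊔ ℓᶜ)) where
  open CommutativeRing K using (ring) renaming (Carrier to 𝕂)
  field
    leftModule : LeftModule ring c ℓᶜ

  open LeftModule leftModule public

  field
    ⁅_,_⁆ : Op₂ Carrierᴹ
    ⁅⁆-cong : ∀ {x x′ y y′} → x ≈ᴹ x′ → y ≈ᴹ y′ → ⁅ x , y ⁆ ≈ᴹ ⁅ x′ , y′ ⁆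
    ⁅⁆-+ˡ : ∀ x y z → ⁅ x +ᴹ y , z ⁆ ≈ᴹ ⁅ x , z ⁆ +ᴹ ⁅ y , z ⁆
    ⁅⁆-+ʳ : ∀ x y z → ⁅ x , y +ᴹ z ⁆ ≈ᴹ ⁅ x , y ⁆ +ᴹ ⁅ x , z ⁆
    ⁅⁆-*ˡ : ∀ k x y → ⁅ k *ₗ x , y ⁆ ≈ᴹ k *ₗ ⁅ x , y ⁆
    ⁅⁆-*ʳ : ∀ k x y → ⁅ x , k *ₗ y ⁆ ≈ᴹ k *ₗ ⁅ x , y ⁆
    alternating : ∀ x → ⁅ x , x ⁆ ≈ᴹ 0ᴹ
    jacobi : ∀ x y z → (⁅ x , ⁅ y , z ⁆ ⁆ +ᴹ ⁅ y , ⁅ z , x ⁆ ⁆) +ᴹ ⁅ z , ⁅ x , y ⁆ ⁆ ≈ᴹ 0ᴹ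

module Interleave {a ℓ} (M : CommutativeMonoid a ℓ) where
  open CommutativeMonoid M renaming (_∙_ to _+_; ∙-congʳ to +-congʳ)
  open CommutativeSemigroupProperties commutativeSemigroup using (interchange)

  interleave₃ : ∀ a b c d e f → ((a + b) + (c + d)) + (e + f) ≈ ((a + c) + e) + ((b + d) + f)
  interleave₃ a b c d e f =
    trans (+-congʳ (interchange a b c d)) (interchange (a + c) (b + d) e f)

-- The coefficients may be any commutative ring K, in particular ℂ.
module _ {a ℓ} (K : CommutativeRing a ℓ) where

  open CommutativeRing K renaming (Carrier to 𝕂)
  open Sum semiring using (sum-cong-≋; sum-replicate-zero; ∑-distrib-+; ∑-comm; *-distribˡ-sum; *-distribʳ-sum)
    renaming (sum to ∑)
  open RingProperties ring using (-‿distribʳ-*; -‿distribˡ-*; x[y-z]≈xy-xz; [y-z]x≈yx-zx)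
  open AbelianGroupProperties +-abelianGroup using (⁻¹-∙-comm; ⁻¹-anti-homo‿-)
  open GroupProperties +-group using (ε⁻¹≈ε)
  open CommutativeSemigroupProperties +-commutativeSemigroup using (interchange)
  open CommutativeSemigroupProperties *-commutativeSemigroup using ()
    renaming (x∙yz≈y∙xz to *-left-comm)
  open Interleave +-commutativeMonoid using (interleave₃)

  Matrix : ℕ → Set a
  Matrix n = Fin n → Fin n → 𝕂

  _·_ : ∀ {n} → Matrix n → Matrix n → Matrix n
  (A · B) i j = ∑ (λ k → A i k * B k j)

  StrictlyLower : ∀ {n} → Matrix n → Set ℓ
  StrictlyLower A = ∀ i j → i Fin.≤ j → A i j ≈ 0#

  elementary : ∀ {n} (p q : Fin n) → Matrix n
  elementary p q r s with r Fin.≟ p | s Fin.≟ q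
  ... | yes _ | yes _ = 1#
  ... | yes _ | no _ = 0#
  ... | no _ | _ = 0#

  elementary-lower : ∀ {n} (p q : Fin n) → .(q Fin.< p) → StrictlyLower (elementary p q)
  elementary-lower p q q<p r s r≤s with r Fin.≟ p | s Fin.≟ q
  ... | yes ≡.refl | yes ≡.refl = contradiction-irr q<p (ℕ.≤⇒≯ r≤s)
  ... | yes _ | no _ = refl
  ... | no _ | _ = refl

  _≋_ : ∀ {n} → Matrix n → Matrix n → Set ℓ
  A ≋ B = ∀ i j → A i j ≈ B i j

  ·-cong : ∀ {n} {A A′ B B′ : Matrix n} → A ≋ A′ → B ≋ B′ → (A · B) ≋ (A′ · B′)
  ·-cong A≋ B≋ i j = sum-cong-≋ (λ k → *-cong (A≋ i k) (B≋ k j))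

  ·-+ˡ : ∀ {n} (A B C : Matrix n) → ((λ i j → A i j + B i j) · C) ≋ (λ i j → (A · C) i j + (B · C) i j)
  ·-+ˡ A B C i j = trans (sum-cong-≋ (λ k → distribʳ (C k j) (A i k) (B i k)))
    (∑-distrib-+ (λ k → A i k * C k j) (λ k → B i k * C k j))

  ·-+ʳ : ∀ {n} (A B C : Matrix n) → (C · (λ i j → A i j + B i j)) ≋ (λ i j → (C · A) i j + (C · B) i j)
  ·-+ʳ A B C i j = trans (sum-cong-≋ (λ k → distribˡ (C i k) (A k j) (B k j)))
    (∑-distrib-+ (λ k → C i k * A k j) (λ k → C i k * B k j))

  ∑-neg : ∀ {n} (f : Fin n → 𝕂) → ∑ (λ i → - f i) ≈ - ∑ f
  ∑-neg {zero} f = sym ε⁻¹≈ε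
  ∑-neg {suc n} f = trans (+-congˡ (∑-neg (f ∘ suc))) (⁻¹-∙-comm _ _)

  ∑-sub : ∀ {n} (f g : Fin n → 𝕂) → ∑ (λ i → f i - g i) ≈ ∑ f - ∑ g
  ∑-sub f g = trans (∑-distrib-+ f (λ i → - g i)) (+-congˡ (∑-neg g))

  ·-subˡ : ∀ {n} (A B C : Matrix n) → ((λ i j → A i j - B i j) · C) ≋ (λ i j → (A · C) i j - (B · C) i j)
  ·-subˡ A B C i j = trans (sum-cong-≋ (λ k → [y-z]x≈yx-zx (C k j) (A i k) (B i k)))
    (∑-sub (λ k → A i k * C k j) (λ k → B i k * C k j))

  ·-subʳ : ∀ {n} (A B C : Matrix n) → (C · (λ i j → A i j - B i j)) ≋ (λ i j → (C · A) i j - (C · B) i j)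
  ·-subʳ A B C i j = trans (sum-cong-≋ (λ k → x[y-z]≈xy-xz (C i k) (A k j) (B k j)))
    (∑-sub (λ k → C i k * A k j) (λ k → C i k * B k j))

  ·-*ˡ : ∀ {n} x (A B : Matrix n) → ((λ i j → x * A i j) · B) ≋ (λ i j → x * (A · B) i j)
  ·-*ˡ x A B i j = trans (sum-cong-≋ (λ k → *-assoc x (A i k) (B k j)))
    (sym (*-distribˡ-sum x (λ k → A i k * B k j)))

  ·-*ʳ : ∀ {n} x (A B : Matrix n) → (A · (λ i j → x * B i j)) ≋ (λ i j → x * (A · B) i j)
  ·-*ʳ x A B i j = trans
    (sum-cong-≋ (λ k → *-left-comm (A i k) x (B k j)))
    (sym (*-distribˡ-sum x (λ k → A i k * B k j)))

  ·-assoc : ∀ {n} (A B C : Matrix n) → ((A · B) · C) ≋ (A · (B · C))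
  ·-assoc A B C i j = trans
    (sum-cong-≋ (λ k → trans (*-distribʳ-sum (C k j) (λ l → A i l * B l k)) (sum-cong-≋ (λ l → *-assoc (A i l) (B l k) (C k j)))))
    (trans (∑-comm (λ k l → A i l * (B l k * C k j)))
      (sum-cong-≋ (λ l → sym (*-distribˡ-sum (A i l) (λ k → B l k * C k j)))))

  ·-lower : ∀ {n} {A B : Matrix n} → StrictlyLower A → StrictlyLower B → StrictlyLower (A · B)
  ·-lower {n} {A} {B} A↓ B↓ i j i≤j = trans (sum-cong-≋ vanish) (sum-replicate-zero n)
    where
    vanish : ∀ k → A i k * B k j ≈ 0#
    vanish k with i Fin.≤? k
    ... | yes i≤k = trans (*-congʳ (A↓ i k i≤k)) (zeroˡ _)
    ... | no i≰k = trans (*-congˡ (B↓ k j (ℕ.≤-trans (ℕ.<⇒≤ (ℕ.≰⇒> i≰k)) i≤j))) (zeroʳ _)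

  0-0≈0 : ∀ {x y} → x ≈ 0# → y ≈ 0# → x - y ≈ 0#
  0-0≈0 x≈0 y≈0 = trans (+-cong x≈0 (trans (-‿cong y≈0) ε⁻¹≈ε)) (+-identityˡ _)

  sub-+ : ∀ w x y z → (w + x) - (y + z) ≈ (w - y) + (x - z)
  sub-+ w x y z = trans (+-congˡ (sym (⁻¹-∙-comm y z))) (interchange w x (- y) (- z))

  cancel : ∀ u v w x y z →
    (((u - v) + (x - w)) + ((w - y) + (v - z))) + ((z - x) + (y - u)) ≈ 0#
  cancel u v w x y z = trans
    (+-cong (+-cong (collect u v x w) (collect w y v z)) (collect z x y u))
    (trans (interleave₃ _ _ _ _ _ _)
      (trans (+-congˡ negatives) (-‿inverseʳ _)))
    where
    collect : ∀ p q r s → (p - q) + (r - s) ≈ (p + r) - (q + s)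
    collect p q r s = trans (interchange p (- q) r (- s)) (+-congˡ (⁻¹-∙-comm q s))

    negatives : (- (v + w) - (y + z)) - (x + u) ≈ - (((u + x) + (w + v)) + (z + y))
    negatives = trans (+-congʳ (⁻¹-∙-comm _ _)) (trans (⁻¹-∙-comm _ _) (-‿cong
      (trans (+-comm _ _) (trans (sym (+-assoc _ _ _))
        (+-cong (+-cong (+-comm x u) (+-comm v w)) (+-comm y z))))))

  commutator : ∀ {n} → Matrix n → Matrix n → Matrix n
  commutator A B i j = (A · B) i j - (B · A) i j

  commutator-jacobi : ∀ {n} (A B C : Matrix n) → ∀ i j →
    (commutator A (commutator B C) i j + commutator B (commutator C A) i j) +
    commutator C (commutator A B) i j ≈ 0#
  commutator-jacobi A B C i j = trans
    (+-cong (+-cong (expand A B C) (expand B C A)) (expand C A B))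
    (cancel _ _ _ _ _ _)
    where
    expand : ∀ X Y Z → commutator X (commutator Y Z) i j ≈
      ((X · (Y · Z)) i j - (X · (Z · Y)) i j) + ((Z · (Y · X)) i j - (Y · (Z · X)) i j)
    expand X Y Z = +-cong (·-subʳ (Y · Z) (Z · Y) X i j)
      (trans (-‿cong (trans (·-subˡ (Y · Z) (Z · Y) X i j)
          (+-cong (·-assoc Y Z X i j) (-‿cong (·-assoc Z Y X i j)))))
        (⁻¹-anti-homo‿- _ _))

  -- The Lie algebra 𝔫⁻ of strictly lower triangular n × n matrices over K.
  𝔫⁻ : ℕ → LieAlgebra K (a ⊔ ℓ) ℓ
  𝔫⁻ n = record
    { leftModule = record
      { Carrierᴹ = Σ[ A ∈ Matrix n ] StrictlyLower A
      ; _≈ᴹ_ = λ (A , _) (B , _) → A ≋ B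
      ; _+ᴹ_ = λ (A , A↓) (B , B↓) → (λ i j → A i j + B i j) ,
          λ i j i≤j → trans (+-cong (A↓ i j i≤j) (B↓ i j i≤j)) (+-identityˡ _)
      ; _*ₗ_ = λ x (A , A↓) → (λ i j → x * A i j) ,
          λ i j i≤j → trans (*-congˡ (A↓ i j i≤j)) (zeroʳ _)
      ; 0ᴹ = (λ _ _ → 0#) , λ _ _ _ → refl
      ; -ᴹ_ = λ (A , A↓) → (λ i j → - A i j) ,
          λ i j i≤j → trans (-‿cong (A↓ i j i≤j)) ε⁻¹≈ε
      ; isLeftModule = record
        { isLeftSemimodule = record
          { +ᴹ-isCommutativeMonoid = record
            { isMonoid = record
              { isSemigroup = record
                { isMagma = record
                  { isEquivalence = record
                    { refl = λ _ _ → refl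
                    ; sym = λ p i j → sym (p i j)
                    ; trans = λ p q i j → trans (p i j) (q i j)
                    }
                  ; ∙-cong = λ p q i j → +-cong (p i j) (q i j)
                  }
                ; assoc = λ _ _ _ _ _ → +-assoc _ _ _
                }
              ; identity = (λ _ _ _ → +-identityˡ _) , (λ _ _ _ → +-identityʳ _)
              }
            ; comm = λ _ _ _ _ → +-comm _ _
            }
          ; isPreleftSemimodule = record
            { *ₗ-cong = λ p q i j → *-cong p (q i j)
            ; *ₗ-zeroˡ = λ _ _ _ → zeroˡ _
            ; *ₗ-distribʳ = λ _ _ _ _ _ → distribʳ _ _ _
            ; *ₗ-identityˡ = λ _ _ _ → *-identityˡ _
            ; *ₗ-assoc = λ _ _ _ _ _ → *-assoc _ _ _
            ; *ₗ-zeroʳ = λ _ _ _ → zeroʳ _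
            ; *ₗ-distribˡ = λ _ _ _ _ _ → distribˡ _ _ _
            }
          }
        ; -ᴹ‿cong = λ p i j → -‿cong (p i j)
        ; -ᴹ‿inverse = (λ _ _ _ → -‿inverseˡ _) , (λ _ _ _ → -‿inverseʳ _)
        }
      }
    ; ⁅_,_⁆ = λ (A , A↓) (B , B↓) → commutator A B ,
        λ i j i≤j → 0-0≈0 (·-lower A↓ B↓ i j i≤j) (·-lower B↓ A↓ i j i≤j)
    ; ⁅⁆-cong = λ p q i j → +-cong (·-cong p q i j) (-‿cong (·-cong q p i j))
    ; ⁅⁆-+ˡ = λ (A , _) (B , _) (C , _) i j →
        trans (+-cong (·-+ˡ A B C i j) (-‿cong (·-+ʳ A B C i j))) (sub-+ _ _ _ _)
    ; ⁅⁆-+ʳ = λ (A , _) (B , _) (C , _) i j →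
        trans (+-cong (·-+ʳ B C A i j) (-‿cong (·-+ˡ B C A i j))) (sub-+ _ _ _ _)
    ; ⁅⁆-*ˡ = λ x (A , _) (B , _) i j →
        trans (+-cong (·-*ˡ x A B i j) (-‿cong (·-*ʳ x B A i j))) (sym (x[y-z]≈xy-xz x _ _))
    ; ⁅⁆-*ʳ = λ x (A , _) (B , _) i j →
        trans (+-cong (·-*ʳ x A B i j) (-‿cong (·-*ˡ x B A i j))) (sym (x[y-z]≈xy-xz x _ _))
    ; alternating = λ _ _ _ → -‿inverseʳ _
    ; jacobi = λ (A , _) (B , _) (C , _) → commutator-jacobi A B C
    }

  E : ∀ {n} (p q : Fin n) → .(q Fin.< p) → LieAlgebra.Carrierᴹ (𝔫⁻ n)
  E p q q<p = elementary p q , elementary-lower p q q<p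

  -- K[t], as the commutative K-algebra freely generated by t: polynomial
  -- expressions modulo the laws of commutative K-algebras.
  infixl 6 _+ᵖ_
  infixl 7 _*ᵖ_
  infix 4 _≈ᵖ_

  data Poly : Set a where
    const : 𝕂 → Poly
    t : Poly
    _+ᵖ_ _*ᵖ_ : Poly → Poly → Poly
    -ᵖ_ : Poly → Poly

  data _≈ᵖ_ : Poly → Poly → Set (a ⊔ ℓ) where
    reflᵖ : ∀ {f} → f ≈ᵖ f
    symᵖ : ∀ {f g} → f ≈ᵖ g → g ≈ᵖ f
    transᵖ : ∀ {f g h} → f ≈ᵖ g → g ≈ᵖ h → f ≈ᵖ h
    +ᵖ-cong : ∀ {f f′ g g′} → f ≈ᵖ f′ → g ≈ᵖ g′ → f +ᵖ g ≈ᵖ f′ +ᵖ g′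
    *ᵖ-cong : ∀ {f f′ g g′} → f ≈ᵖ f′ → g ≈ᵖ g′ → f *ᵖ g ≈ᵖ f′ *ᵖ g′
    -ᵖ-cong : ∀ {f f′} → f ≈ᵖ f′ → -ᵖ f ≈ᵖ -ᵖ f′
    const-cong : ∀ {x y} → x ≈ y → const x ≈ᵖ const y
    +ᵖ-assoc : ∀ f g h → (f +ᵖ g) +ᵖ h ≈ᵖ f +ᵖ (g +ᵖ h)
    +ᵖ-comm : ∀ f g → f +ᵖ g ≈ᵖ g +ᵖ f
    +ᵖ-identityˡ : ∀ f → const 0# +ᵖ f ≈ᵖ f
    -ᵖ-inverseˡ : ∀ f → (-ᵖ f) +ᵖ f ≈ᵖ const 0#
    *ᵖ-assoc : ∀ f g h → (f *ᵖ g) *ᵖ h ≈ᵖ f *ᵖ (g *ᵖ h)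
    *ᵖ-comm : ∀ f g → f *ᵖ g ≈ᵖ g *ᵖ f
    *ᵖ-identityˡ : ∀ f → const 1# *ᵖ f ≈ᵖ f
    *ᵖ-distribˡ-+ᵖ : ∀ f g h → f *ᵖ (g +ᵖ h) ≈ᵖ f *ᵖ g +ᵖ f *ᵖ h
    const-+ : ∀ x y → const (x + y) ≈ᵖ const x +ᵖ const y
    const-* : ∀ x y → const (x * y) ≈ᵖ const x *ᵖ const y

  t^_ : ℕ → Poly
  t^ zero = const 1#
  t^ suc k = t *ᵖ t^ k

  module Current {c ℓᶜ} (𝔤 : LieAlgebra K c ℓᶜ) where

    open LieAlgebra 𝔤

    infix 4 _≈ᶜ_
    infixl 6 _+ᶜ_
    infix 8 _⊗_

    -- 𝔤 ⊗ K[t], as the abelian group generated by the symbols x ⊗ f modulo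
    -- bilinearity over K.
    data Tensor : Set (a ⊔ c) where
      _⊗_ : Carrierᴹ → Poly → Tensor
      0ᶜ : Tensor
      _+ᶜ_ : Tensor → Tensor → Tensor
      -ᶜ_ : Tensor → Tensor

    data _≈ᶜ_ : Tensor → Tensor → Set (a ⊔ ℓ ⊔ c ⊔ ℓᶜ) where
      reflᶜ : ∀ {u} → u ≈ᶜ u
      symᶜ : ∀ {u v} → u ≈ᶜ v → v ≈ᶜ u
      transᶜ : ∀ {u v w} → u ≈ᶜ v → v ≈ᶜ w → u ≈ᶜ w
      +ᶜ-cong : ∀ {u u′ v v′} → u ≈ᶜ u′ → v ≈ᶜ v′ → u +ᶜ v ≈ᶜ u′ +ᶜ v′
      -ᶜ-cong : ∀ {u u′} → u ≈ᶜ u′ → -ᶜ u ≈ᶜ -ᶜ u′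
      ⊗-cong : ∀ {x x′ f f′} → x ≈ᴹ x′ → f ≈ᵖ f′ → x ⊗ f ≈ᶜ x′ ⊗ f′
      +ᶜ-assoc : ∀ u v w → (u +ᶜ v) +ᶜ w ≈ᶜ u +ᶜ (v +ᶜ w)
      +ᶜ-comm : ∀ u v → u +ᶜ v ≈ᶜ v +ᶜ u
      +ᶜ-identityˡ : ∀ u → 0ᶜ +ᶜ u ≈ᶜ u
      -ᶜ-inverseˡ : ∀ u → (-ᶜ u) +ᶜ u ≈ᶜ 0ᶜ
      ⊗-+ˡ : ∀ x y f → (x +ᴹ y) ⊗ f ≈ᶜ x ⊗ f +ᶜ y ⊗ f
      ⊗-+ʳ : ∀ x f g → x ⊗ (f +ᵖ g) ≈ᶜ x ⊗ f +ᶜ x ⊗ g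
      ⊗-*ₗ : ∀ k x f → (k *ₗ x) ⊗ f ≈ᶜ x ⊗ (const k *ᵖ f)

    _*ᶜ_ : 𝕂 → Tensor → Tensor
    k *ᶜ (x ⊗ f) = (k *ₗ x) ⊗ f
    k *ᶜ 0ᶜ = 0ᶜ
    k *ᶜ (u +ᶜ v) = (k *ᶜ u) +ᶜ (k *ᶜ v)
    k *ᶜ (-ᶜ u) = -ᶜ (k *ᶜ u)

    -- The bilinear extension of [x ⊗ f , y ⊗ g] = [x , y] ⊗ fg.
    ad⊗ : Carrierᴹ → Poly → Tensor → Tensor
    ad⊗ x f (y ⊗ g) = ⁅ x , y ⁆ ⊗ (f *ᵖ g)
    ad⊗ x f 0ᶜ = 0ᶜ
    ad⊗ x f (u +ᶜ v) = ad⊗ x f u +ᶜ ad⊗ x f v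
    ad⊗ x f (-ᶜ u) = -ᶜ ad⊗ x f u

    bracket : Tensor → Tensor → Tensor
    bracket (x ⊗ f) w = ad⊗ x f w
    bracket 0ᶜ w = 0ᶜ
    bracket (u +ᶜ v) w = bracket u w +ᶜ bracket v w
    bracket (-ᶜ u) w = -ᶜ bracket u w

    +ᶜ-commutativeMonoid : CommutativeMonoid (a ⊔ c) (a ⊔ ℓ ⊔ c ⊔ ℓᶜ)
    +ᶜ-commutativeMonoid = record
      { isCommutativeMonoid = record
        { isMonoid = record
          { isSemigroup = record
            { isMagma = record
              { isEquivalence = record { refl = reflᶜ ; sym = symᶜ ; trans = transᶜ }
              ; ∙-cong = +ᶜ-cong
              }
            ; assoc = +ᶜ-assoc
            }
          ; identity = +ᶜ-identityˡ , λ u → transᶜ (+ᶜ-comm u 0ᶜ) (+ᶜ-identityˡ u)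
          }
        ; comm = +ᶜ-comm
        }
      }

    -ᶜ-inverseʳ : ∀ u → u +ᶜ (-ᶜ u) ≈ᶜ 0ᶜ
    -ᶜ-inverseʳ u = transᶜ (+ᶜ-comm _ _) (-ᶜ-inverseˡ u)

    +ᶜ-group : AbelianGroup (a ⊔ c) (a ⊔ ℓ ⊔ c ⊔ ℓᶜ)
    +ᶜ-group = record
      { isAbelianGroup = record
        { isGroup = record
          { isMonoid = CommutativeMonoid.isMonoid +ᶜ-commutativeMonoid
          ; inverse = -ᶜ-inverseˡ , -ᶜ-inverseʳ
          ; ⁻¹-cong = -ᶜ-cong
          }
        ; comm = +ᶜ-comm
        }
      }

    -ᶜ-+ᶜ : ∀ u v → (-ᶜ u) +ᶜ (-ᶜ v) ≈ᶜ -ᶜ (u +ᶜ v)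
    -ᶜ-+ᶜ = AbelianGroupProperties.⁻¹-∙-comm +ᶜ-group

    -0ᶜ≈0ᶜ : -ᶜ 0ᶜ ≈ᶜ 0ᶜ
    -0ᶜ≈0ᶜ = GroupProperties.ε⁻¹≈ε (AbelianGroup.group +ᶜ-group)

    identityˡ-unique : ∀ u v → u +ᶜ v ≈ᶜ v → u ≈ᶜ 0ᶜ
    identityˡ-unique = GroupProperties.identityˡ-unique (AbelianGroup.group +ᶜ-group)

    +ᶜ-interchange : ∀ u v w x → (u +ᶜ v) +ᶜ (w +ᶜ x) ≈ᶜ (u +ᶜ w) +ᶜ (v +ᶜ x)
    +ᶜ-interchange = CommutativeSemigroupProperties.interchange
      (CommutativeMonoid.commutativeSemigroup +ᶜ-commutativeMonoid)

    0ᶜ+0ᶜ : ∀ {u v} → u ≈ᶜ 0ᶜ → v ≈ᶜ 0ᶜ → u +ᶜ v ≈ᶜ 0ᶜ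
    0ᶜ+0ᶜ u≈0 v≈0 = transᶜ (+ᶜ-cong u≈0 v≈0) (+ᶜ-identityˡ 0ᶜ)

    -ᶜ-zero : ∀ {u} → u ≈ᶜ 0ᶜ → -ᶜ u ≈ᶜ 0ᶜ
    -ᶜ-zero u≈0 = transᶜ (-ᶜ-cong u≈0) -0ᶜ≈0ᶜ

    0⊗ : ∀ f → 0ᴹ ⊗ f ≈ᶜ 0ᶜ
    0⊗ f = identityˡ-unique _ (0ᴹ ⊗ f)
      (transᶜ (symᶜ (⊗-+ˡ 0ᴹ 0ᴹ f)) (⊗-cong (+ᴹ-identityˡ 0ᴹ) reflᵖ))

    -- Both *ᶜ and the bracket are well defined.
    *ᶜ-cong : ∀ k {u v} → u ≈ᶜ v → k *ᶜ u ≈ᶜ k *ᶜ v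
    *ᶜ-cong k reflᶜ = reflᶜ
    *ᶜ-cong k (symᶜ p) = symᶜ (*ᶜ-cong k p)
    *ᶜ-cong k (transᶜ p q) = transᶜ (*ᶜ-cong k p) (*ᶜ-cong k q)
    *ᶜ-cong k (+ᶜ-cong p q) = +ᶜ-cong (*ᶜ-cong k p) (*ᶜ-cong k q)
    *ᶜ-cong k (-ᶜ-cong p) = -ᶜ-cong (*ᶜ-cong k p)
    *ᶜ-cong k (⊗-cong p q) = ⊗-cong (*ₗ-cong refl p) q
    *ᶜ-cong k (+ᶜ-assoc u v w) = +ᶜ-assoc _ _ _
    *ᶜ-cong k (+ᶜ-comm u v) = +ᶜ-comm _ _
    *ᶜ-cong k (+ᶜ-identityˡ u) = +ᶜ-identityˡ _
    *ᶜ-cong k (-ᶜ-inverseˡ u) = -ᶜ-inverseˡ _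
    *ᶜ-cong k (⊗-+ˡ x y f) = transᶜ (⊗-cong (*ₗ-distribˡ k x y) reflᵖ) (⊗-+ˡ _ _ f)
    *ᶜ-cong k (⊗-+ʳ x f g) = ⊗-+ʳ _ f g
    *ᶜ-cong k (⊗-*ₗ l x f) = transᶜ
      (⊗-cong (≈ᴹ-trans (≈ᴹ-sym (*ₗ-assoc k l x)) (≈ᴹ-trans (*ₗ-cong (*-comm k l) ≈ᴹ-refl) (*ₗ-assoc l k x))) reflᵖ)
      (⊗-*ₗ l (k *ₗ x) f)

    *ᶜ-congˡ : ∀ {k l} → k ≈ l → ∀ u → k *ᶜ u ≈ᶜ l *ᶜ u
    *ᶜ-congˡ p (x ⊗ f) = ⊗-cong (*ₗ-cong p ≈ᴹ-refl) reflᵖ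
    *ᶜ-congˡ p 0ᶜ = reflᶜ
    *ᶜ-congˡ p (u +ᶜ v) = +ᶜ-cong (*ᶜ-congˡ p u) (*ᶜ-congˡ p v)
    *ᶜ-congˡ p (-ᶜ u) = -ᶜ-cong (*ᶜ-congˡ p u)

    *ᶜ-zeroˡ : ∀ u → 0# *ᶜ u ≈ᶜ 0ᶜ
    *ᶜ-zeroˡ (x ⊗ f) = transᶜ (⊗-cong (*ₗ-zeroˡ x) reflᵖ) (0⊗ f)
    *ᶜ-zeroˡ 0ᶜ = reflᶜ
    *ᶜ-zeroˡ (u +ᶜ v) = 0ᶜ+0ᶜ (*ᶜ-zeroˡ u) (*ᶜ-zeroˡ v)
    *ᶜ-zeroˡ (-ᶜ u) = -ᶜ-zero (*ᶜ-zeroˡ u)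

    *ᶜ-distribʳ : ∀ u k l → (k + l) *ᶜ u ≈ᶜ (k *ᶜ u) +ᶜ (l *ᶜ u)
    *ᶜ-distribʳ (x ⊗ f) k l = transᶜ (⊗-cong (*ₗ-distribʳ x k l) reflᵖ) (⊗-+ˡ _ _ f)
    *ᶜ-distribʳ 0ᶜ k l = symᶜ (+ᶜ-identityˡ 0ᶜ)
    *ᶜ-distribʳ (u +ᶜ v) k l =
      transᶜ (+ᶜ-cong (*ᶜ-distribʳ u k l) (*ᶜ-distribʳ v k l)) (+ᶜ-interchange _ _ _ _)
    *ᶜ-distribʳ (-ᶜ u) k l = transᶜ (-ᶜ-cong (*ᶜ-distribʳ u k l)) (symᶜ (-ᶜ-+ᶜ _ _))

    *ᶜ-identityˡ : ∀ u → 1# *ᶜ u ≈ᶜ u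
    *ᶜ-identityˡ (x ⊗ f) = ⊗-cong (*ₗ-identityˡ x) reflᵖ
    *ᶜ-identityˡ 0ᶜ = reflᶜ
    *ᶜ-identityˡ (u +ᶜ v) = +ᶜ-cong (*ᶜ-identityˡ u) (*ᶜ-identityˡ v)
    *ᶜ-identityˡ (-ᶜ u) = -ᶜ-cong (*ᶜ-identityˡ u)

    *ᶜ-assoc : ∀ k l u → (k * l) *ᶜ u ≈ᶜ k *ᶜ (l *ᶜ u)
    *ᶜ-assoc k l (x ⊗ f) = ⊗-cong (*ₗ-assoc k l x) reflᵖ
    *ᶜ-assoc k l 0ᶜ = reflᶜ
    *ᶜ-assoc k l (u +ᶜ v) = +ᶜ-cong (*ᶜ-assoc k l u) (*ᶜ-assoc k l v)
    *ᶜ-assoc k l (-ᶜ u) = -ᶜ-cong (*ᶜ-assoc k l u)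

    *ᵖ-left-comm : ∀ f g h → f *ᵖ (g *ᵖ h) ≈ᵖ g *ᵖ (f *ᵖ h)
    *ᵖ-left-comm f g h = transᵖ (symᵖ (*ᵖ-assoc f g h))
      (transᵖ (*ᵖ-cong (*ᵖ-comm f g) reflᵖ) (*ᵖ-assoc g f h))

    *ᵖ-distribʳ : ∀ f g h → (f +ᵖ g) *ᵖ h ≈ᵖ f *ᵖ h +ᵖ g *ᵖ h
    *ᵖ-distribʳ f g h = transᵖ (*ᵖ-comm _ h)
      (transᵖ (*ᵖ-distribˡ-+ᵖ h f g) (+ᵖ-cong (*ᵖ-comm h f) (*ᵖ-comm h g)))

    ad⊗-cong : ∀ x f {u v} → u ≈ᶜ v → ad⊗ x f u ≈ᶜ ad⊗ x f v
    ad⊗-cong x f reflᶜ = reflᶜ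
    ad⊗-cong x f (symᶜ p) = symᶜ (ad⊗-cong x f p)
    ad⊗-cong x f (transᶜ p q) = transᶜ (ad⊗-cong x f p) (ad⊗-cong x f q)
    ad⊗-cong x f (+ᶜ-cong p q) = +ᶜ-cong (ad⊗-cong x f p) (ad⊗-cong x f q)
    ad⊗-cong x f (-ᶜ-cong p) = -ᶜ-cong (ad⊗-cong x f p)
    ad⊗-cong x f (⊗-cong p q) = ⊗-cong (⁅⁆-cong ≈ᴹ-refl p) (*ᵖ-cong reflᵖ q)
    ad⊗-cong x f (+ᶜ-assoc u v w) = +ᶜ-assoc _ _ _
    ad⊗-cong x f (+ᶜ-comm u v) = +ᶜ-comm _ _
    ad⊗-cong x f (+ᶜ-identityˡ u) = +ᶜ-identityˡ _
    ad⊗-cong x f (-ᶜ-inverseˡ u) = -ᶜ-inverseˡ _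
    ad⊗-cong x f (⊗-+ˡ y z g) = transᶜ (⊗-cong (⁅⁆-+ʳ x y z) reflᵖ) (⊗-+ˡ _ _ _)
    ad⊗-cong x f (⊗-+ʳ y g h) = transᶜ (⊗-cong ≈ᴹ-refl (*ᵖ-distribˡ-+ᵖ f g h)) (⊗-+ʳ _ _ _)
    ad⊗-cong x f (⊗-*ₗ k y g) = transᶜ (⊗-cong (⁅⁆-*ʳ k x y) reflᵖ)
      (transᶜ (⊗-*ₗ k _ _) (⊗-cong ≈ᴹ-refl (*ᵖ-left-comm (const k) f g)))

    ad⊗-congˡ : ∀ {x y f g} → x ≈ᴹ y → f ≈ᵖ g → ∀ u → ad⊗ x f u ≈ᶜ ad⊗ y g u
    ad⊗-congˡ p q (z ⊗ h) = ⊗-cong (⁅⁆-cong p ≈ᴹ-refl) (*ᵖ-cong q reflᵖ)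
    ad⊗-congˡ p q 0ᶜ = reflᶜ
    ad⊗-congˡ p q (u +ᶜ v) = +ᶜ-cong (ad⊗-congˡ p q u) (ad⊗-congˡ p q v)
    ad⊗-congˡ p q (-ᶜ u) = -ᶜ-cong (ad⊗-congˡ p q u)

    ad⊗-+ˡ : ∀ x y f u → ad⊗ (x +ᴹ y) f u ≈ᶜ ad⊗ x f u +ᶜ ad⊗ y f u
    ad⊗-+ˡ x y f (z ⊗ h) = transᶜ (⊗-cong (⁅⁆-+ˡ x y z) reflᵖ) (⊗-+ˡ _ _ _)
    ad⊗-+ˡ x y f 0ᶜ = symᶜ (+ᶜ-identityˡ 0ᶜ)
    ad⊗-+ˡ x y f (u +ᶜ v) =
      transᶜ (+ᶜ-cong (ad⊗-+ˡ x y f u) (ad⊗-+ˡ x y f v)) (+ᶜ-interchange _ _ _ _)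
    ad⊗-+ˡ x y f (-ᶜ u) = transᶜ (-ᶜ-cong (ad⊗-+ˡ x y f u)) (symᶜ (-ᶜ-+ᶜ _ _))

    ad⊗-+ʳ : ∀ x f g u → ad⊗ x (f +ᵖ g) u ≈ᶜ ad⊗ x f u +ᶜ ad⊗ x g u
    ad⊗-+ʳ x f g (z ⊗ h) = transᶜ (⊗-cong ≈ᴹ-refl (*ᵖ-distribʳ f g h)) (⊗-+ʳ _ _ _)
    ad⊗-+ʳ x f g 0ᶜ = symᶜ (+ᶜ-identityˡ 0ᶜ)
    ad⊗-+ʳ x f g (u +ᶜ v) =
      transᶜ (+ᶜ-cong (ad⊗-+ʳ x f g u) (ad⊗-+ʳ x f g v)) (+ᶜ-interchange _ _ _ _)
    ad⊗-+ʳ x f g (-ᶜ u) = transᶜ (-ᶜ-cong (ad⊗-+ʳ x f g u)) (symᶜ (-ᶜ-+ᶜ _ _))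

    ad⊗-*ₗ : ∀ k x f u → ad⊗ (k *ₗ x) f u ≈ᶜ ad⊗ x (const k *ᵖ f) u
    ad⊗-*ₗ k x f (z ⊗ h) = transᶜ (⊗-cong (⁅⁆-*ˡ k x z) reflᵖ)
      (transᶜ (⊗-*ₗ k _ _) (⊗-cong ≈ᴹ-refl (symᵖ (*ᵖ-assoc _ _ _))))
    ad⊗-*ₗ k x f 0ᶜ = reflᶜ
    ad⊗-*ₗ k x f (u +ᶜ v) = +ᶜ-cong (ad⊗-*ₗ k x f u) (ad⊗-*ₗ k x f v)
    ad⊗-*ₗ k x f (-ᶜ u) = -ᶜ-cong (ad⊗-*ₗ k x f u)

    bracket-congˡ : ∀ {u v} → u ≈ᶜ v → ∀ w → bracket u w ≈ᶜ bracket v w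
    bracket-congˡ reflᶜ w = reflᶜ
    bracket-congˡ (symᶜ p) w = symᶜ (bracket-congˡ p w)
    bracket-congˡ (transᶜ p q) w = transᶜ (bracket-congˡ p w) (bracket-congˡ q w)
    bracket-congˡ (+ᶜ-cong p q) w = +ᶜ-cong (bracket-congˡ p w) (bracket-congˡ q w)
    bracket-congˡ (-ᶜ-cong p) w = -ᶜ-cong (bracket-congˡ p w)
    bracket-congˡ (⊗-cong p q) w = ad⊗-congˡ p q w
    bracket-congˡ (+ᶜ-assoc _ _ _) w = +ᶜ-assoc _ _ _
    bracket-congˡ (+ᶜ-comm _ _) w = +ᶜ-comm _ _
    bracket-congˡ (+ᶜ-identityˡ _) w = +ᶜ-identityˡ _
    bracket-congˡ (-ᶜ-inverseˡ _) w = -ᶜ-inverseˡ _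
    bracket-congˡ (⊗-+ˡ x y f) w = ad⊗-+ˡ x y f w
    bracket-congˡ (⊗-+ʳ x f g) w = ad⊗-+ʳ x f g w
    bracket-congˡ (⊗-*ₗ k x f) w = ad⊗-*ₗ k x f w

    bracket-congʳ : ∀ u {v w} → v ≈ᶜ w → bracket u v ≈ᶜ bracket u w
    bracket-congʳ (x ⊗ f) p = ad⊗-cong x f p
    bracket-congʳ 0ᶜ p = reflᶜ
    bracket-congʳ (u +ᶜ v) p = +ᶜ-cong (bracket-congʳ u p) (bracket-congʳ v p)
    bracket-congʳ (-ᶜ u) p = -ᶜ-cong (bracket-congʳ u p)

    bracket-0ʳ : ∀ u → bracket u 0ᶜ ≈ᶜ 0ᶜ
    bracket-0ʳ (x ⊗ f) = reflᶜ
    bracket-0ʳ 0ᶜ = reflᶜ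
    bracket-0ʳ (u +ᶜ v) = 0ᶜ+0ᶜ (bracket-0ʳ u) (bracket-0ʳ v)
    bracket-0ʳ (-ᶜ u) = -ᶜ-zero (bracket-0ʳ u)

    bracket-+ʳ : ∀ u v w → bracket u (v +ᶜ w) ≈ᶜ bracket u v +ᶜ bracket u w
    bracket-+ʳ (x ⊗ f) v w = reflᶜ
    bracket-+ʳ 0ᶜ v w = symᶜ (+ᶜ-identityˡ 0ᶜ)
    bracket-+ʳ (u +ᶜ u′) v w =
      transᶜ (+ᶜ-cong (bracket-+ʳ u v w) (bracket-+ʳ u′ v w)) (+ᶜ-interchange _ _ _ _)
    bracket-+ʳ (-ᶜ u) v w = transᶜ (-ᶜ-cong (bracket-+ʳ u v w)) (symᶜ (-ᶜ-+ᶜ _ _))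

    bracket--ʳ : ∀ u v → bracket u (-ᶜ v) ≈ᶜ -ᶜ bracket u v
    bracket--ʳ (x ⊗ f) v = reflᶜ
    bracket--ʳ 0ᶜ v = symᶜ -0ᶜ≈0ᶜ
    bracket--ʳ (u +ᶜ u′) v = transᶜ (+ᶜ-cong (bracket--ʳ u v) (bracket--ʳ u′ v)) (-ᶜ-+ᶜ _ _)
    bracket--ʳ (-ᶜ u) v = -ᶜ-cong (bracket--ʳ u v)

    ad⊗-*ˡ : ∀ k x f u → ad⊗ (k *ₗ x) f u ≈ᶜ k *ᶜ ad⊗ x f u
    ad⊗-*ˡ k x f (y ⊗ g) = ⊗-cong (⁅⁆-*ˡ k x y) reflᵖ
    ad⊗-*ˡ k x f 0ᶜ = reflᶜ
    ad⊗-*ˡ k x f (u +ᶜ v) = +ᶜ-cong (ad⊗-*ˡ k x f u) (ad⊗-*ˡ k x f v)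
    ad⊗-*ˡ k x f (-ᶜ u) = -ᶜ-cong (ad⊗-*ˡ k x f u)

    bracket-*ˡ : ∀ k u v → bracket (k *ᶜ u) v ≈ᶜ k *ᶜ bracket u v
    bracket-*ˡ k (x ⊗ f) v = ad⊗-*ˡ k x f v
    bracket-*ˡ k 0ᶜ v = reflᶜ
    bracket-*ˡ k (u +ᶜ u′) v = +ᶜ-cong (bracket-*ˡ k u v) (bracket-*ˡ k u′ v)
    bracket-*ˡ k (-ᶜ u) v = -ᶜ-cong (bracket-*ˡ k u v)

    ad⊗-*ʳ : ∀ k x f u → ad⊗ x f (k *ᶜ u) ≈ᶜ k *ᶜ ad⊗ x f u
    ad⊗-*ʳ k x f (y ⊗ g) = ⊗-cong (⁅⁆-*ʳ k x y) reflᵖ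
    ad⊗-*ʳ k x f 0ᶜ = reflᶜ
    ad⊗-*ʳ k x f (u +ᶜ v) = +ᶜ-cong (ad⊗-*ʳ k x f u) (ad⊗-*ʳ k x f v)
    ad⊗-*ʳ k x f (-ᶜ u) = -ᶜ-cong (ad⊗-*ʳ k x f u)

    bracket-*ʳ : ∀ k u v → bracket u (k *ᶜ v) ≈ᶜ k *ᶜ bracket u v
    bracket-*ʳ k (x ⊗ f) v = ad⊗-*ʳ k x f v
    bracket-*ʳ k 0ᶜ v = reflᶜ
    bracket-*ʳ k (u +ᶜ u′) v = +ᶜ-cong (bracket-*ʳ k u v) (bracket-*ʳ k u′ v)
    bracket-*ʳ k (-ᶜ u) v = -ᶜ-cong (bracket-*ʳ k u v)

    ⁅⁆-antisym : ∀ x y → ⁅ x , y ⁆ +ᴹ ⁅ y , x ⁆ ≈ᴹ 0ᴹ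
    ⁅⁆-antisym x y = ≈ᴹ-trans (≈ᴹ-sym expanded) (alternating (x +ᴹ y))
      where
      expanded : ⁅ x +ᴹ y , x +ᴹ y ⁆ ≈ᴹ ⁅ x , y ⁆ +ᴹ ⁅ y , x ⁆
      expanded = ≈ᴹ-trans (⁅⁆-+ˡ x y (x +ᴹ y)) (+ᴹ-cong
        (≈ᴹ-trans (⁅⁆-+ʳ x x y) (≈ᴹ-trans (+ᴹ-cong (alternating x) ≈ᴹ-refl) (+ᴹ-identityˡ _)))
        (≈ᴹ-trans (⁅⁆-+ʳ y x y) (≈ᴹ-trans (+ᴹ-cong ≈ᴹ-refl (alternating y)) (+ᴹ-identityʳ _))))

    ad⊗-antisym : ∀ x f v → ad⊗ x f v +ᶜ bracket v (x ⊗ f) ≈ᶜ 0ᶜ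
    ad⊗-antisym x f (y ⊗ g) = transᶜ (+ᶜ-cong reflᶜ (⊗-cong ≈ᴹ-refl (*ᵖ-comm g f)))
      (transᶜ (symᶜ (⊗-+ˡ _ _ _)) (transᶜ (⊗-cong (⁅⁆-antisym x y) reflᵖ) (0⊗ _)))
    ad⊗-antisym x f 0ᶜ = +ᶜ-identityˡ 0ᶜ
    ad⊗-antisym x f (u +ᶜ v) =
      transᶜ (+ᶜ-interchange _ _ _ _) (0ᶜ+0ᶜ (ad⊗-antisym x f u) (ad⊗-antisym x f v))
    ad⊗-antisym x f (-ᶜ u) = transᶜ (-ᶜ-+ᶜ _ _) (-ᶜ-zero (ad⊗-antisym x f u))

    bracket-antisym : ∀ u v → bracket u v +ᶜ bracket v u ≈ᶜ 0ᶜ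
    bracket-antisym (x ⊗ f) v = ad⊗-antisym x f v
    bracket-antisym 0ᶜ v = transᶜ (+ᶜ-identityˡ _) (bracket-0ʳ v)
    bracket-antisym (u +ᶜ u′) v = transᶜ (+ᶜ-cong reflᶜ (bracket-+ʳ v u u′))
      (transᶜ (+ᶜ-interchange _ _ _ _) (0ᶜ+0ᶜ (bracket-antisym u v) (bracket-antisym u′ v)))
    bracket-antisym (-ᶜ u) v = transᶜ (+ᶜ-cong reflᶜ (bracket--ʳ v u))
      (transᶜ (-ᶜ-+ᶜ _ _) (-ᶜ-zero (bracket-antisym u v)))

    bracket-alternating : ∀ u → bracket u u ≈ᶜ 0ᶜ
    bracket-alternating (x ⊗ f) = transᶜ (⊗-cong (alternating x) reflᵖ) (0⊗ _)
    bracket-alternating 0ᶜ = reflᶜ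
    bracket-alternating (u +ᶜ v) = transᶜ
      (+ᶜ-cong (bracket-+ʳ u u v) (transᶜ (bracket-+ʳ v u v) (+ᶜ-comm _ _)))
      (transᶜ (+ᶜ-interchange _ _ _ _)
        (0ᶜ+0ᶜ (0ᶜ+0ᶜ (bracket-alternating u) (bracket-alternating v)) (bracket-antisym u v)))
    bracket-alternating (-ᶜ u) = -ᶜ-zero (transᶜ (bracket--ʳ u u) (-ᶜ-zero (bracket-alternating u)))

    Jacobi : Tensor → Tensor → Tensor → Set (a ⊔ ℓ ⊔ c ⊔ ℓᶜ)
    Jacobi u v w =
      (bracket u (bracket v w) +ᶜ bracket v (bracket w u)) +ᶜ bracket w (bracket u v) ≈ᶜ 0ᶜ

    rotate : ∀ {u v w} → Jacobi u v w → Jacobi v w u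
    rotate j = transᶜ (transᶜ (+ᶜ-comm _ _) (symᶜ (+ᶜ-assoc _ _ _))) j

    -- Jacobi is closed under the operations in the first argument.
    jacobi-0 : ∀ v w → Jacobi 0ᶜ v w
    jacobi-0 v w = 0ᶜ+0ᶜ
      (0ᶜ+0ᶜ reflᶜ (transᶜ (bracket-congʳ v (bracket-0ʳ w)) (bracket-0ʳ v))) (bracket-0ʳ w)

    jacobi-+ : ∀ u u′ v w → Jacobi u v w → Jacobi u′ v w → Jacobi (u +ᶜ u′) v w
    jacobi-+ u u′ v w j j′ = transᶜ
      (+ᶜ-cong (+ᶜ-cong reflᶜ (transᶜ (bracket-congʳ v (bracket-+ʳ w u u′)) (bracket-+ʳ v _ _)))
        (bracket-+ʳ w _ _))
      (transᶜ (Interleave.interleave₃ +ᶜ-commutativeMonoid _ _ _ _ _ _) (0ᶜ+0ᶜ j j′))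

    jacobi-- : ∀ u v w → Jacobi u v w → Jacobi (-ᶜ u) v w
    jacobi-- u v w j = transᶜ
      (+ᶜ-cong (+ᶜ-cong reflᶜ (transᶜ (bracket-congʳ v (bracket--ʳ w u)) (bracket--ʳ v _)))
        (bracket--ʳ w _))
      (transᶜ (+ᶜ-cong (-ᶜ-+ᶜ _ _) reflᶜ) (transᶜ (-ᶜ-+ᶜ _ _) (-ᶜ-zero j)))

    jacobi₃ : ∀ x f y g z h → Jacobi (x ⊗ f) (y ⊗ g) (z ⊗ h)
    jacobi₃ x f y g z h = transᶜ
      (+ᶜ-cong
        (+ᶜ-cong reflᶜ (⊗-cong ≈ᴹ-refl
          (transᵖ (*ᵖ-cong reflᵖ (*ᵖ-comm h f)) (*ᵖ-left-comm g f h))))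
        (⊗-cong ≈ᴹ-refl (transᵖ (*ᵖ-comm h _) (*ᵖ-assoc f g h))))
      (transᶜ (+ᶜ-cong (symᶜ (⊗-+ˡ _ _ _)) reflᶜ)
        (transᶜ (symᶜ (⊗-+ˡ _ _ _)) (transᶜ (⊗-cong (jacobi x y z) reflᵖ) (0⊗ _))))

    jacobi₂ : ∀ u y g z h → Jacobi u (y ⊗ g) (z ⊗ h)
    jacobi₂ (x ⊗ f) y g z h = jacobi₃ x f y g z h
    jacobi₂ 0ᶜ y g z h = jacobi-0 (y ⊗ g) (z ⊗ h)
    jacobi₂ (u +ᶜ v) y g z h = jacobi-+ u v (y ⊗ g) (z ⊗ h) (jacobi₂ u y g z h) (jacobi₂ v y g z h)
    jacobi₂ (-ᶜ u) y g z h = jacobi-- u (y ⊗ g) (z ⊗ h) (jacobi₂ u y g z h)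

    jacobi₁ : ∀ u v z h → Jacobi v (z ⊗ h) u
    jacobi₁ u (y ⊗ g) z h = rotate {u} {y ⊗ g} {z ⊗ h} (jacobi₂ u y g z h)
    jacobi₁ u 0ᶜ z h = jacobi-0 (z ⊗ h) u
    jacobi₁ u (v +ᶜ w) z h = jacobi-+ v w (z ⊗ h) u (jacobi₁ u v z h) (jacobi₁ u w z h)
    jacobi₁ u (-ᶜ v) z h = jacobi-- v (z ⊗ h) u (jacobi₁ u v z h)

    jacobi₀ : ∀ u v w → Jacobi w u v
    jacobi₀ u v (z ⊗ h) = rotate {v} {z ⊗ h} {u} (jacobi₁ u v z h)
    jacobi₀ u v 0ᶜ = jacobi-0 u v
    jacobi₀ u v (w +ᶜ w′) = jacobi-+ w w′ u v (jacobi₀ u v w) (jacobi₀ u v w′)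
    jacobi₀ u v (-ᶜ w) = jacobi-- w u v (jacobi₀ u v w)

    current : LieAlgebra K (a ⊔ c) (a ⊔ ℓ ⊔ c ⊔ ℓᶜ)
    current = record
      { leftModule = record
        { Carrierᴹ = Tensor
        ; _≈ᴹ_ = _≈ᶜ_
        ; _+ᴹ_ = _+ᶜ_
        ; _*ₗ_ = _*ᶜ_
        ; 0ᴹ = 0ᶜ
        ; -ᴹ_ = -ᶜ_
        ; isLeftModule = record
          { isLeftSemimodule = record
            { +ᴹ-isCommutativeMonoid = CommutativeMonoid.isCommutativeMonoid +ᶜ-commutativeMonoid
            ; isPreleftSemimodule = record
              { *ₗ-cong = λ {k} {l} {u} {v} p q → transᶜ (*ᶜ-cong k q) (*ᶜ-congˡ p v)
              ; *ₗ-zeroˡ = *ᶜ-zeroˡ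
              ; *ₗ-distribʳ = *ᶜ-distribʳ
              ; *ₗ-identityˡ = *ᶜ-identityˡ
              ; *ₗ-assoc = *ᶜ-assoc
              ; *ₗ-zeroʳ = λ _ → reflᶜ
              ; *ₗ-distribˡ = λ _ _ _ → reflᶜ
              }
            }
          ; -ᴹ‿cong = -ᶜ-cong
          ; -ᴹ‿inverse = -ᶜ-inverseˡ , -ᶜ-inverseʳ
          }
        }
      ; ⁅_,_⁆ = bracket
      ; ⁅⁆-cong = λ {u} {u′} {v} {v′} p q → transᶜ (bracket-congˡ p v) (bracket-congʳ u′ q)
      ; ⁅⁆-+ˡ = λ _ _ _ → reflᶜ
      ; ⁅⁆-+ʳ = bracket-+ʳ
      ; ⁅⁆-*ˡ = bracket-*ˡ
      ; ⁅⁆-*ʳ = bracket-*ʳ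
      ; alternating = bracket-alternating
      ; jacobi = λ u v w → jacobi₀ v w u
      }

  -- The universal enveloping algebra: the associative unital K-algebra
  -- generated by 𝔤 subject to linearity of ι and ι [x , y] = ι x ι y - ι y ι x.
  module Enveloping {c ℓᶜ} (𝔤 : LieAlgebra K c ℓᶜ) where

    open LieAlgebra 𝔤

    infix 4 _≈ᵘ_
    infixl 6 _+ᵘ_
    infixl 7 _*ᵘ_

    data Term : Set (a ⊔ c) where
      ι : Carrierᴹ → Term
      scalar : 𝕂 → Term
      _+ᵘ_ _*ᵘ_ : Term → Term → Term
      -ᵘ_ : Term → Term

    data _≈ᵘ_ : Term → Term → Set (a ⊔ ℓ ⊔ c ⊔ ℓᶜ) where
      reflᵘ : ∀ {u} → u ≈ᵘ u
      symᵘ : ∀ {u v} → u ≈ᵘ v → v ≈ᵘ u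
      transᵘ : ∀ {u v w} → u ≈ᵘ v → v ≈ᵘ w → u ≈ᵘ w
      +ᵘ-cong : ∀ {u u′ v v′} → u ≈ᵘ u′ → v ≈ᵘ v′ → u +ᵘ v ≈ᵘ u′ +ᵘ v′
      *ᵘ-cong : ∀ {u u′ v v′} → u ≈ᵘ u′ → v ≈ᵘ v′ → u *ᵘ v ≈ᵘ u′ *ᵘ v′
      -ᵘ-cong : ∀ {u u′} → u ≈ᵘ u′ → -ᵘ u ≈ᵘ -ᵘ u′
      ι-cong : ∀ {x y} → x ≈ᴹ y → ι x ≈ᵘ ι y
      scalar-cong : ∀ {k l} → k ≈ l → scalar k ≈ᵘ scalar l
      +ᵘ-assoc : ∀ u v w → (u +ᵘ v) +ᵘ w ≈ᵘ u +ᵘ (v +ᵘ w)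
      +ᵘ-comm : ∀ u v → u +ᵘ v ≈ᵘ v +ᵘ u
      +ᵘ-identityˡ : ∀ u → scalar 0# +ᵘ u ≈ᵘ u
      -ᵘ-inverseˡ : ∀ u → (-ᵘ u) +ᵘ u ≈ᵘ scalar 0#
      *ᵘ-assoc : ∀ u v w → (u *ᵘ v) *ᵘ w ≈ᵘ u *ᵘ (v *ᵘ w)
      *ᵘ-identityˡ : ∀ u → scalar 1# *ᵘ u ≈ᵘ u
      *ᵘ-distribˡ-+ᵘ : ∀ u v w → u *ᵘ (v +ᵘ w) ≈ᵘ u *ᵘ v +ᵘ u *ᵘ w
      *ᵘ-distribʳ-+ᵘ : ∀ u v w → (v +ᵘ w) *ᵘ u ≈ᵘ v *ᵘ u +ᵘ w *ᵘ u
      scalar-+ : ∀ k l → scalar (k + l) ≈ᵘ scalar k +ᵘ scalar l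
      scalar-* : ∀ k l → scalar (k * l) ≈ᵘ scalar k *ᵘ scalar l
      scalar-central : ∀ k u → scalar k *ᵘ u ≈ᵘ u *ᵘ scalar k
      ι-+ : ∀ x y → ι (x +ᴹ y) ≈ᵘ ι x +ᵘ ι y
      ι-*ₗ : ∀ k x → ι (k *ₗ x) ≈ᵘ scalar k *ᵘ ι x
      ι-⁅⁆ : ∀ x y → ι ⁅ x , y ⁆ ≈ᵘ ι x *ᵘ ι y +ᵘ (-ᵘ (ι y *ᵘ ι x))

    𝔘 : Ring (a ⊔ c) (a ⊔ ℓ ⊔ c ⊔ ℓᶜ)
    𝔘 = record
      { Carrier = Term
      ; _≈_ = _≈ᵘ_
      ; _+_ = _+ᵘ_
      ; _*_ = _*ᵘ_
      ; -_ = -ᵘ_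
      ; 0# = scalar 0#
      ; 1# = scalar 1#
      ; isRing = record
        { +-isAbelianGroup = record
          { isGroup = record
            { isMonoid = record
              { isSemigroup = record
                { isMagma = record
                  { isEquivalence = record { refl = reflᵘ ; sym = symᵘ ; trans = transᵘ }
                  ; ∙-cong = +ᵘ-cong
                  }
                ; assoc = +ᵘ-assoc
                }
              ; identity = +ᵘ-identityˡ , λ u → transᵘ (+ᵘ-comm u _) (+ᵘ-identityˡ u)
              }
            ; inverse = -ᵘ-inverseˡ , λ u → transᵘ (+ᵘ-comm u _) (-ᵘ-inverseˡ u)
            ; ⁻¹-cong = -ᵘ-cong
            }
          ; comm = +ᵘ-comm
          }
        ; *-cong = *ᵘ-cong
        ; *-assoc = *ᵘ-assoc
        ; *-identity = *ᵘ-identityˡ ,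
            λ u → transᵘ (symᵘ (scalar-central 1# u)) (*ᵘ-identityˡ u)
        ; distrib = *ᵘ-distribˡ-+ᵘ , *ᵘ-distribʳ-+ᵘ
        }
      }

    ∏ : List Term → Term
    ∏ = foldr _*ᵘ_ (scalar 1#)

  open Current using (_⊗_; current)
  open Enveloping using (Term; ι; ∏; 𝔘)

  𝔫⁻[t] : ∀ n → LieAlgebra K (a ⊔ ℓ) (a ⊔ ℓ)
  𝔫⁻[t] n = current (𝔫⁻ n)

  𝔘𝔫⁻[t] : ∀ n → Ring (a ⊔ ℓ) (a ⊔ ℓ)
  𝔘𝔫⁻[t] n = 𝔘 (𝔫⁻[t] n)

  module _ {m} {μ : Partition (suc m)} where

    𝕃ᵢⱼ : POP μ → (i j : Fin m) → .(i Fin.≤ j) → Term (𝔫⁻[t] (suc m))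
    𝕃ᵢⱼ P i j i≤j =
      ∏ _ (map (λ e → ι (E (suc j) (inject₁ i) (≤̄⇒inject₁< i≤j) ⊗ t^ e)) (parts (Λ P i j i≤j)))

    𝕃ⱼ : POP μ → Fin m → Term (𝔫⁻[t] (suc m))
    𝕃ⱼ P j = ∏ _ (map (λ (i : Fin′ (suc j)) → 𝕃ᵢⱼ P (inject! i) j (s≤s⁻¹ (inject!-< i))) (allFin (suc (toℕ j))))

    CL : POP μ → Term (𝔫⁻[t] (suc m))
    CL P = ∏ _ (map (𝕃ⱼ P) (allFin m))

    𝔟-quinv 𝔟-inv : CSF μ → Term (𝔫⁻[t] (suc m))
    𝔟-quinv F = CL (ψ-quinv F)
    𝔟-inv F = CL (ψ-inv F)

    orderedProduct : (z : Cell μ → ℕ) {F : CSF μ} → IncreasingEnumeration F → Term (𝔫⁻[t] (suc m))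
    orderedProduct z {F} e =
      ∏ _ (All.reduce (λ {c} i<F → ι (E (entry F c) (row c) i<F ⊗ t^ z c)) (row<entry e))

{-# OPTIONS --safe #-}

-- (1) In a column strict filling every cell y outside the first row is a
-- descent. Let x be the cell above y and c another cell in the row of x, on the
-- appropriate side. As F x < F y, the numbers [F x < F c] and [F c < F y] sum to
-- 1 + [F x < F c < F y], and the 1 is one of the cells counted by the arm. If
-- there is no cell below x, then [F x < F c] is [F x < F c < ∞]. Summing over all
-- x and c gives quinv or inv, according to the side; for inv, the pairs (y, c)
-- number as many as the pairs of cells in the row of y, which the arms count.
-- (2) zcount + zcount-bar is the number of x in the row with F x < F c, minus the
-- number of y in the next row with F y ≤ F c, and rsort determines both.
-- (3) E p q and E p q′ commute for q, q′ < p, as their products vanish. So a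
-- product of such factors that is weakly increasing in p depends only on the
-- multiset of factors.

module Submission where

open import Defs
open import Algebra using (CommutativeRing; Monoid; Ring)
import Algebra.Properties.CommutativeMonoid.Sum as CommutativeMonoidSum
import Algebra.Properties.Group as GroupProperties
open import Data.Fin as Fin using (Fin; Fin′; zero; suc; toℕ; fromℕ; inject₁; inject!; inject≤)
import Data.Fin.Properties as Fin
open import Data.Fin.Relation.Unary.Top using (view; ‵fromℕ; ‵inject₁)
open import Data.Integer as ℤ using (+_)
import Data.Integer.Properties as ℤ
open import Data.List as List using (List; []; _∷_; _++_; length; map; filter; reverse; concatMap;
  cartesianProduct; allFin; tabulate; foldr)
open import Data.List.Membership.Propositional using (_∈_)
open import Data.List.Membership.Propositional.Properties
  using (∈-∃++; ∈-map⁺; ∈-map⁻; ∈-concat⁺′; ∈-concat⁻′; ∈-filter⁺; ∈-filter⁻; ∈-allFin)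
open import Data.List.Membership.Propositional.Properties.WithK using (unique∧set⇒bag)
import Data.List.Properties as List
open import Data.List.Relation.Binary.BagAndSetEquality using (∼bag⇒↭)
open import Data.List.Relation.Binary.Permutation.Propositional using (_↭_; ↭-refl; ↭-sym; ↭-trans; ↭⇒↭ₛ)
open import Data.List.Relation.Binary.Permutation.Propositional.Properties
  using (All-resp-↭; ∈-resp-↭; drop-mid; filter-↭; ↭-empty-inv; ↭-length; ↭-reverse)
open import Data.List.Relation.Binary.Permutation.Setoid.Properties using (Unique-resp-↭)
open import Data.List.Relation.Unary.All as All using (All; []; _∷_)
import Data.List.Relation.Unary.All.Properties as All
open import Data.List.Relation.Unary.AllPairs as AllPairs using (AllPairs; []; _∷_)
import Data.List.Relation.Unary.AllPairs.Properties as AllPairs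
open import Data.List.Relation.Unary.Any using (here)
import Data.List.Sort as Sort
open import Data.Maybe as Maybe using (nothing)
open import Data.Nat as ℕ using (ℕ; zero; suc; _+_; _*_; z≤n; s≤s; s≤s⁻¹; _<?_)
open import Data.Nat.ListAction using (sum)
open import Data.Nat.ListAction.Properties using (sum-++)
import Data.Nat.Properties as ℕ
open import Data.Product using (∃; _×_; _,_; proj₁; proj₂; map₁)
open import Data.Sum using (_⊎_; inj₁; inj₂)
open import Function using (_∘_; id; mk⇔)
open import Level using (Level)
open import Relation.Binary using (Rel; tri<; tri≈; tri>) renaming (Decidable to Decidable₂)
import Relation.Binary.Construct.Add.Supremum.Strict as Supremum
open import Relation.Binary.PropositionalEquality as ≡ using (_≡_; _≢_)
import Relation.Binary.Reasoning.Setoid as SetoidReasoning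
open import Relation.Nullary using (Dec; yes; no; ¬_; _×-dec_; _⊎-dec_; contradiction; contradiction-irr)
open import Relation.Nullary.Construct.Add.Supremum renaming ([_] to finite)
open import Relation.Unary using (Pred; Decidable)
open import Algebra.Properties.CommutativeSemigroup ℕ.+-commutativeSemigroup using (interchange; xy∙z≈xz∙y)
open CommutativeMonoidSum ℕ.+-0-commutativeMonoid
  using (sum-cong-≗; ∑-distrib-+; ∑-comm; sum-init-last; sum-replicate-zero) renaming (sum to ∑)

private
  variable
    a b c p q r ℓ : Level
    A : Set a
    B : Set b
    C : Set c
    P : Set p
    Q : Set q
    R : Set r
    k l m n : ℕ

-- Iverson brackets of decisions, and counts as finite sums of them.

⟦_⟧ : Dec P → ℕ
⟦ yes _ ⟧ = 1
⟦ no _ ⟧ = 0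

⟦⟧-⇔ : (P → Q) → (Q → P) → (P? : Dec P) (Q? : Dec Q) → ⟦ P? ⟧ ≡ ⟦ Q? ⟧
⟦⟧-⇔ P⇒Q Q⇒P (yes _) (yes _) = ≡.refl
⟦⟧-⇔ P⇒Q Q⇒P (yes x) (no ¬y) = contradiction (P⇒Q x) ¬y
⟦⟧-⇔ P⇒Q Q⇒P (no ¬x) (yes y) = contradiction (Q⇒P y) ¬x
⟦⟧-⇔ P⇒Q Q⇒P (no _) (no _) = ≡.refl

⟦⟧-yes : P → (P? : Dec P) → ⟦ P? ⟧ ≡ 1
⟦⟧-yes x (yes _) = ≡.refl
⟦⟧-yes x (no ¬x) = contradiction x ¬x

⟦⟧-no : ¬ P → (P? : Dec P) → ⟦ P? ⟧ ≡ 0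
⟦⟧-no ¬x (yes x) = contradiction x ¬x
⟦⟧-no ¬x (no _) = ≡.refl

⟦⟧-⊎-× : (P? : Dec P) (Q? : Dec Q) (R? : Dec R) → (P → ¬ Q) →
  ⟦ (P? ⊎-dec Q?) ×-dec R? ⟧ ≡ ⟦ P? ×-dec R? ⟧ + ⟦ Q? ×-dec R? ⟧
⟦⟧-⊎-× (yes x) (yes y) _ P⇒¬Q = contradiction y (P⇒¬Q x)
⟦⟧-⊎-× (yes _) (no _) (yes _) _ = ≡.refl
⟦⟧-⊎-× (yes _) (no _) (no _) _ = ≡.refl
⟦⟧-⊎-× (no _) (yes _) (yes _) _ = ≡.refl
⟦⟧-⊎-× (no _) (yes _) (no _) _ = ≡.refl
⟦⟧-⊎-× (no _) (no _) (yes _) _ = ≡.refl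
⟦⟧-⊎-× (no _) (no _) (no _) _ = ≡.refl

-- `R` is the disjoint union of `P` and `Q`. Covering is only required when `Q` fails, because the
-- decision of `Q` settles the other case.
⟦⟧-+ : (P? : Dec P) (Q? : Dec Q) (R? : Dec R) →
  (P → ¬ Q) → (P → R) → (Q → R) → (R → ¬ Q → P) → ⟦ P? ⟧ + ⟦ Q? ⟧ ≡ ⟦ R? ⟧
⟦⟧-+ (yes x) (yes y) _ P⇒¬Q _ _ _ = contradiction y (P⇒¬Q x)
⟦⟧-+ (yes x) (no _) R? _ P⇒R _ _ = ≡.sym (⟦⟧-yes (P⇒R x) R?)
⟦⟧-+ (no _) (yes y) R? _ _ Q⇒R _ = ≡.sym (⟦⟧-yes (Q⇒R y) R?)
⟦⟧-+ (no ¬x) (no ¬y) R? _ _ _ R⇒ = ≡.sym (⟦⟧-no (λ z → ¬x (R⇒ z ¬y)) R?)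

-- Inclusion-exclusion for `Q` and `R`, at least one of which holds, relative to `P`. In its use `P`
-- is the side condition on `x` and `c`, `Q` is `F x < F c`, and `R` is `F c < F y` for `y` below
-- `x`.
⟦⟧-crossing : (P? : Dec P) (Q? : Dec Q) (R? : Dec R) → (¬ Q → R) →
  ⟦ P? ×-dec (Q? ×-dec R?) ⟧ + ⟦ P? ⟧ ≡ ⟦ P? ×-dec Q? ⟧ + ⟦ P? ×-dec R? ⟧
⟦⟧-crossing (yes _) (yes _) (yes _) _ = ≡.refl
⟦⟧-crossing (yes _) (yes _) (no _) _ = ≡.refl
⟦⟧-crossing (yes _) (no _) (yes _) _ = ≡.refl
⟦⟧-crossing (yes _) (no ¬y) (no ¬z) ¬Q⇒R = contradiction (¬Q⇒R ¬y) ¬z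
⟦⟧-crossing (no _) _ _ _ = ≡.refl

count≡sum : {P : Pred A p} (P? : Decidable P) (xs : List A) → count P? xs ≡ sum (map (⟦_⟧ ∘ P?) xs)
count≡sum P? [] = ≡.refl
count≡sum P? (x ∷ xs) with P? x
... | yes _ = ≡.cong suc (count≡sum P? xs)
... | no _ = count≡sum P? xs

sum-map-filter : {P : Pred A p} (P? : Decidable P) (f : A → ℕ) (xs : List A) →
  sum (map f (filter P? xs)) ≡ sum (map (λ x → ⟦ P? x ⟧ * f x) xs)
sum-map-filter P? f [] = ≡.refl
sum-map-filter P? f (x ∷ xs) with P? x
... | yes _ = ≡.cong₂ _+_ (≡.sym (ℕ.+-identityʳ (f x))) (sum-map-filter P? f xs)
... | no _ = sum-map-filter P? f xs

sum-map-++ : (f : A → ℕ) (xs ys : List A) → sum (map f (xs ++ ys)) ≡ sum (map f xs) + sum (map f ys)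
sum-map-++ f xs ys = ≡.trans (≡.cong sum (List.map-++ f xs ys)) (sum-++ (map f xs) (map f ys))

sum-map-concatMap : (f : B → ℕ) (g : A → List B) (xs : List A) →
  sum (map f (concatMap g xs)) ≡ sum (map (λ x → sum (map f (g x))) xs)
sum-map-concatMap f g [] = ≡.refl
sum-map-concatMap f g (x ∷ xs) =
  ≡.trans (sum-map-++ f (g x) (concatMap g xs)) (≡.cong₂ _+_ ≡.refl (sum-map-concatMap f g xs))

sum-map-cartesianProduct : (f : A × B → ℕ) (xs : List A) (ys : List B) →
  sum (map f (cartesianProduct xs ys)) ≡ sum (map (λ x → sum (map (λ y → f (x , y)) ys)) xs)
sum-map-cartesianProduct f [] ys = ≡.refl
sum-map-cartesianProduct f (x ∷ xs) ys = ≡.trans (sum-map-++ f (map (x ,_) ys) _)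
  (≡.cong₂ _+_ (≡.cong sum (≡.sym (List.map-∘ ys))) (sum-map-cartesianProduct f xs ys))

sum-map-tabulate : (f : A → ℕ) (g : Fin n → A) → sum (map f (tabulate g)) ≡ ∑ (f ∘ g)
sum-map-tabulate {n = zero} f g = ≡.refl
sum-map-tabulate {n = suc n} f g = ≡.cong₂ _+_ ≡.refl (sum-map-tabulate f (g ∘ suc))

count≡∑ : {P : Pred (Fin n) p} (P? : Decidable P) → count P? (allFin n) ≡ ∑ (⟦_⟧ ∘ P?)
count≡∑ P? = ≡.trans (count≡sum P? (allFin _)) (sum-map-tabulate (⟦_⟧ ∘ P?) id)

sum-map-cells : (μ : Partition n) (f : Cell μ → ℕ) → sum (map f (cells μ)) ≡ ∑ λ r → ∑ λ c → f (r , c)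
sum-map-cells {n} μ f = begin
  sum (map f (cells μ))
    ≡⟨ sum-map-concatMap f (λ r → map (r ,_) (allFin (part μ r))) (allFin n) ⟩
  sum (map (λ r → sum (map f (map (r ,_) (allFin (part μ r))))) (allFin n))
    ≡⟨ sum-map-tabulate (λ r → sum (map f (map (r ,_) (allFin (part μ r))))) id ⟩
  ∑ (λ r → sum (map f (map (r ,_) (allFin (part μ r)))))
    ≡⟨ sum-cong-≗ (λ r → ≡.trans (≡.cong sum (≡.sym (List.map-∘ (allFin (part μ r))))) (sum-map-tabulate (λ c → f (r , c)) id)) ⟩
  (∑ λ r → ∑ λ c → f (r , c)) ∎
  where open ≡.≡-Reasoning

∑-zero : (f : Fin n → ℕ) → (∀ i → f i ≡ 0) → ∑ f ≡ 0
∑-zero {n} f f≡0 = ≡.trans (sum-cong-≗ f≡0) (sum-replicate-zero n)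

∑-single : (f : Fin n → ℕ) (i : Fin n) → (∀ j → j ≢ i → f j ≡ 0) → ∑ f ≡ f i
∑-single f zero f≡0 = ≡.trans (≡.cong₂ _+_ (≡.refl {x = f zero}) (∑-zero (f ∘ suc) λ j → f≡0 (suc j) λ ())) (ℕ.+-identityʳ _)
∑-single f (suc i) f≡0 = ≡.cong₂ _+_ (f≡0 zero λ ())
  (∑-single (f ∘ suc) i λ j j≢i → f≡0 (suc j) (j≢i ∘ Fin.suc-injective))

∑-diagonal : (h : Fin n → Fin n → ℕ) → (∀ r s → r ≢ s → h r s ≡ 0) → (∑ λ r → ∑ λ s → h r s) ≡ ∑ λ r → h r r
∑-diagonal h h≡0 = sum-cong-≗ λ r → ∑-single (h r) r λ s s≢r → h≡0 r s (s≢r ∘ ≡.sym)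

-- The first row lies below no row, so its terms vanish; for row `suc i` only `s = inject₁ i` has
-- the right number. This isolates the attacks on the row above.
∑-subdiagonal : (h : Fin (suc m) → Fin (suc m) → ℕ) → (∀ r s → toℕ r ≢ suc (toℕ s) → h r s ≡ 0) →
  (∑ λ r → ∑ λ s → h r s) ≡ ∑ λ i → h (suc i) (inject₁ i)
∑-subdiagonal h h≡0 = ≡.cong₂ _+_ (∑-zero (h zero) λ s → h≡0 zero s λ ())
  (sum-cong-≗ λ i → ∑-single (h (suc i)) (inject₁ i) λ s s≢i → h≡0 (suc i) s λ i≡s →
    s≢i (Fin.toℕ-injective (≡.trans (≡.sym (ℕ.suc-injective i≡s)) (≡.sym (Fin.toℕ-inject₁ i)))))

-- Meant for a row of length `l` above a row of length `k`: a column that reaches the lower row is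
-- compared together with its lower cell, and any later column on its own.
∑-initial-segment : (k≤l : k ℕ.≤ l) (f g : Fin l → ℕ) (f′ g′ : Fin k → ℕ) →
  (∀ y → f (inject≤ y k≤l) + f′ y ≡ g (inject≤ y k≤l) + g′ y) →
  (∀ x → k ℕ.≤ toℕ x → f x ≡ g x) →
  ∑ f + ∑ f′ ≡ ∑ g + ∑ g′
∑-initial-segment z≤n f g f′ g′ _ f≡g = ≡.cong (_+ 0) (sum-cong-≗ λ x → f≡g x z≤n)
∑-initial-segment (s≤s k≤l) f g f′ g′ ≡-on-segment f≡g = begin
  (f zero + ∑ (f ∘ suc)) + (f′ zero + ∑ (f′ ∘ suc)) ≡⟨ interchange (f zero) _ _ _ ⟩
  (f zero + f′ zero) + (∑ (f ∘ suc) + ∑ (f′ ∘ suc)) ≡⟨ ≡.cong₂ _+_ (≡-on-segment zero)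
    (∑-initial-segment k≤l (f ∘ suc) (g ∘ suc) (f′ ∘ suc) (g′ ∘ suc)
      (≡-on-segment ∘ suc) (λ x k≤x → f≡g (suc x) (s≤s k≤x))) ⟩
  (g zero + g′ zero) + (∑ (g ∘ suc) + ∑ (g′ ∘ suc)) ≡⟨ interchange (g zero) _ _ _ ⟩
  (g zero + ∑ (g ∘ suc)) + (g′ zero + ∑ (g′ ∘ suc)) ∎
  where open ≡.≡-Reasoning

-- The value is independent of `n`, so the cells to the left of a given column are equally many in a
-- row and in the longer row above it.
∑-<-const : (j : ℕ) → j ℕ.≤ n → ∑ {n} (λ i → ⟦ toℕ i <? j ⟧) ≡ j
∑-<-const {zero} zero z≤n = ≡.refl
∑-<-const {suc n} zero z≤n = ∑-zero {suc n} _ λ i → ⟦⟧-no (λ ()) (toℕ i <? 0)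
∑-<-const {suc n} (suc j) (s≤s j≤n) = ≡.cong₂ _+_ (⟦⟧-yes (s≤s z≤n) (0 <? suc j))
  (≡.trans (sum-cong-≗ {n} λ i → ⟦⟧-⇔ ℕ.s≤s⁻¹ s≤s (toℕ (suc i) <? suc j) (toℕ i <? j)) (∑-<-const j j≤n))

-- All counting is done additively in `ℕ`; this passes to the subtraction in the integers `quinv F`
-- and `inv F`.
difference : ∀ {a b c : ℕ} → a + b ≡ c → + a ≡ + c ℤ.- + b
difference {a} {b} ≡.refl = ≡.sym (≡.trans (ℤ.m-n≡m⊖n (a + b) b)
  (≡.trans (ℤ.⊖-≥ (ℕ.m≤n+m b a)) (≡.cong +_ (ℕ.m+n∸n≡m a b))))

-- The sums of `zcount` and `zcount-bar` over all cells.

module _ {μ : Partition (suc m)} (F : CSF μ) where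

  open Supremum (Fin._<_ {suc m} {suc m}) using (_<⁺_; <⁺-dec; [<]-injective; [_]; [_]<⊤⁺)
  open ≡.≡-Reasoning

  cellInRow-nothing : ∀ r j → part μ r ℕ.≤ j → cellInRow μ r j ≡ nothing
  cellInRow-nothing r j μᵣ≤j with j ℕ.<? part μ r
  ... | yes j<μᵣ = contradiction j<μᵣ (ℕ.≤⇒≯ μᵣ≤j)
  ... | no _ = ≡.refl

  cellAt-nothing : ∀ r j → part μ r ℕ.≤ j → cellAt μ (toℕ r) j ≡ nothing
  cellAt-nothing r j μᵣ≤j with toℕ r ℕ.<? suc m
  ... | no r≮n = ≡.refl
  ... | yes r<n =
    ≡.trans (≡.cong (λ s → cellInRow μ s j) (Fin.fromℕ<-toℕ r r<n)) (cellInRow-nothing r j μᵣ≤j)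

  cellAt-beyond : ∀ i j → suc m ℕ.≤ i → cellAt μ i j ≡ nothing
  cellAt-beyond i j n≤i with i ℕ.<? suc m
  ... | yes i<n = contradiction i<n (ℕ.≤⇒≯ n≤i)
  ... | no _ = ≡.refl

  entryBelow-short : ∀ i (x : Fin (part μ (inject₁ i))) → part μ (suc i) ℕ.≤ toℕ x →
    entryBelow F (inject₁ i , x) ≡ nothing
  entryBelow-short i x μᵢ≤x = ≡.cong (Maybe.map (entry F))
    (≡.trans (≡.cong (λ k → cellAt μ (suc k) (toℕ x)) (Fin.toℕ-inject₁ i)) (cellAt-nothing (suc i) (toℕ x) μᵢ≤x))

  entryBelow-last : (x : Fin (part μ (fromℕ m))) → entryBelow F (fromℕ m , x) ≡ nothing
  entryBelow-last x = ≡.cong (Maybe.map (entry F))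
    (cellAt-beyond _ _ (ℕ.≤-reflexive (≡.cong suc (≡.sym (Fin.toℕ-fromℕ m)))))

  below-greater : ∀ i (y : Fin (part μ (suc i))) →
    entry F (inject₁ i , inject≤ y (shorter F i)) Fin.< entry F (suc i , y)
  below-greater i y = column-strict F (Fin.toℕ-inject≤ y (shorter F i)) (Fin.≤̄⇒inject₁< {i = i} ℕ.≤-refl)

  between-∞ : ∀ {c x} → entryBelow F x ≡ nothing → entry F x Fin.< entry F c → Between F c x
  between-∞ {c} ≡∞ x<c = x<c , ≡.subst (finite (entry F c) <⁺_) (≡.sym ≡∞) [ entry F c ]<⊤⁺

  module _ {R : Rel ℕ p} (R? : Decidable₂ R) where

    -- R is < for zcount and quinv, and > for zcount-bar and inv.
    zcountᴿ : Cell μ → ℕ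
    zcountᴿ (r , c) = count (λ x → R? (toℕ x) (toℕ c) ×-dec between? F (r , c) (r , x)) (allFin (part μ r))

    AttacksRow AttacksAbove : Cell μ → Cell μ → Set p
    AttacksRow u v = row u ≡ row v × R (col v) (col u)
    AttacksAbove u v = toℕ (row u) ≡ suc (toℕ (row v)) × R (col u) (col v)

    attacksRow? : ∀ u v → Dec (AttacksRow u v)
    attacksRow? u v = (row u Fin.≟ row v) ×-dec R? (col v) (col u)

    attacksAbove? : ∀ u v → Dec (AttacksAbove u v)
    attacksAbove? u v = (toℕ (row u) ℕ.≟ suc (toℕ (row v))) ×-dec R? (col u) (col v)

    inversions : List (Cell μ × Cell μ)
    inversions = filter
      (λ (u , v) → (attacksRow? u v ⊎-dec attacksAbove? u v) ×-dec (entry F v Fin.<? entry F u))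
      (cartesianProduct (cells μ) (cells μ))

    rowBetween? : ∀ r (x c : Fin (part μ r)) → Dec (R (toℕ x) (toℕ c) × Between F (r , c) (r , x))
    rowBetween? r x c = R? (toℕ x) (toℕ c) ×-dec between? F (r , c) (r , x)

    rowInversion? : ∀ r (x c : Fin (part μ r)) → Dec (R (toℕ x) (toℕ c) × entry F (r , x) Fin.< entry F (r , c))
    rowInversion? r x c = R? (toℕ x) (toℕ c) ×-dec (entry F (r , x) Fin.<? entry F (r , c))

    rowInversionAbove? : ∀ i (y : Fin (part μ (suc i))) (c : Fin (part μ (inject₁ i))) →
      Dec (R (toℕ y) (toℕ c) × entry F (inject₁ i , c) Fin.< entry F (suc i , y))
    rowInversionAbove? i y c = R? (toℕ y) (toℕ c) ×-dec (entry F (inject₁ i , c) Fin.<? entry F (suc i , y))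

    -- These pairs are the ones that the arms count. Here `y` stands for the cell above it, hence
    -- the `inject≤`, and `c` ranges over the row of that upper cell.
    rowPair? : ∀ i (y : Fin (part μ (suc i))) (c : Fin (part μ (inject₁ i))) →
      Dec (R (toℕ (inject≤ y (shorter F i))) (toℕ c))
    rowPair? i y c = R? (toℕ (inject≤ y (shorter F i))) (toℕ c)

    -- An attack stays within a row or goes to the row just above, so the double sum over rows
    -- collapses to its diagonal and its subdiagonal.
    length-inversions : length inversions ≡
      (∑ λ r → ∑ λ x → ∑ λ c → ⟦ rowInversion? r x c ⟧) + (∑ λ i → ∑ λ y → ∑ λ c → ⟦ rowInversionAbove? i y c ⟧)
    length-inversions = begin
      length inversions
        ≡⟨ count≡sum _ (cartesianProduct (cells μ) (cells μ)) ⟩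
      _ ≡⟨ sum-map-cartesianProduct (λ (u , v) → I u v) (cells μ) (cells μ) ⟩
      sum (map (λ u → sum (map (I u) (cells μ))) (cells μ))
        ≡⟨ sum-map-cells μ _ ⟩
      (∑ λ r → ∑ λ c → sum (map (I (r , c)) (cells μ)))
        ≡⟨ sum-cong-≗ (λ r → sum-cong-≗ λ c → sum-map-cells μ (I (r , c))) ⟩
      (∑ λ r → ∑ λ c → ∑ λ s → ∑ λ d → I (r , c) (s , d))
        -- Both row indices have to stand outside the column indices before the sum over pairs of
        -- rows can collapse.
        ≡⟨ sum-cong-≗ (λ r → ∑-comm λ c s → ∑ λ d → I (r , c) (s , d)) ⟩
      (∑ λ r → ∑ λ s → ∑ λ c → ∑ λ d → I (r , c) (s , d))
        ≡⟨ sum-cong-≗ (λ r → sum-cong-≗ λ s → ≡.trans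
             (sum-cong-≗ λ c → ≡.trans (sum-cong-≗ λ d → I-split (r , c) (s , d))
               (∑-distrib-+ (λ d → Iᴿ (r , c) (s , d)) (λ d → Iᴬ (r , c) (s , d))))
             (∑-distrib-+ (λ c → ∑ λ d → Iᴿ (r , c) (s , d)) (λ c → ∑ λ d → Iᴬ (r , c) (s , d)))) ⟩
      (∑ λ r → ∑ λ s → hᴿ r s + hᴬ r s)
        ≡⟨ sum-cong-≗ (λ r → ∑-distrib-+ (hᴿ r) (hᴬ r)) ⟩
      (∑ λ r → ∑ (hᴿ r) + ∑ (hᴬ r))
        ≡⟨ ∑-distrib-+ (∑ ∘ hᴿ) (∑ ∘ hᴬ) ⟩
      (∑ λ r → ∑ λ s → hᴿ r s) + (∑ λ r → ∑ λ s → hᴬ r s)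
        ≡⟨ ≡.cong₂ _+_
             (∑-diagonal hᴿ λ r s r≢s → ∑-zero _ λ c → ∑-zero _ λ d →
               ⟦⟧-no (r≢s ∘ proj₁ ∘ proj₁) (invᴿ? (r , c) (s , d)))
             (∑-subdiagonal hᴬ λ r s r≢1+s → ∑-zero _ λ c → ∑-zero _ λ d →
               ⟦⟧-no (r≢1+s ∘ proj₁ ∘ proj₁) (invᴬ? (r , c) (s , d))) ⟩
      (∑ λ r → hᴿ r r) + (∑ λ i → hᴬ (suc i) (inject₁ i))
        ≡⟨ ≡.cong₂ _+_
             (sum-cong-≗ λ r → ≡.trans
               -- The attacked cell, which has the smaller entry, becomes the outer index: it plays
               -- the part of `x`, whose lower neighbour matters in `Between`.
               (∑-comm λ c d → Iᴿ (r , c) (r , d))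
               (sum-cong-≗ λ d → sum-cong-≗ λ c → 
                 ⟦⟧-⇔ (map₁ proj₂) (map₁ (≡.refl ,_)) (invᴿ? (r , c) (r , d)) (rowInversion? r d c)))
             (sum-cong-≗ λ i → sum-cong-≗ λ y → sum-cong-≗ λ c →
               ⟦⟧-⇔ (map₁ proj₂) (map₁ (≡.cong suc (≡.sym (Fin.toℕ-inject₁ i)) ,_))
                 (invᴬ? (suc i , y) (inject₁ i , c)) (rowInversionAbove? i y c)) ⟩
      _ ∎
      where
      invᴿ? : ∀ u v → Dec (AttacksRow u v × entry F v Fin.< entry F u)
      invᴿ? u v = attacksRow? u v ×-dec (entry F v Fin.<? entry F u)
      invᴬ? : ∀ u v → Dec (AttacksAbove u v × entry F v Fin.< entry F u)
      invᴬ? u v = attacksAbove? u v ×-dec (entry F v Fin.<? entry F u)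

      I Iᴿ Iᴬ : Cell μ → Cell μ → ℕ
      I u v = ⟦ (attacksRow? u v ⊎-dec attacksAbove? u v) ×-dec (entry F v Fin.<? entry F u) ⟧
      Iᴿ u v = ⟦ invᴿ? u v ⟧
      Iᴬ u v = ⟦ invᴬ? u v ⟧

      I-split : ∀ u v → I u v ≡ Iᴿ u v + Iᴬ u v
      I-split u v = ⟦⟧-⊎-× (attacksRow? u v) (attacksAbove? u v) (entry F v Fin.<? entry F u)
        λ (u≡v , _) (u≡1+v , _) → ℕ.1+n≢n (≡.trans (≡.sym u≡1+v) (≡.cong toℕ u≡v))

      hᴿ hᴬ : Fin (suc m) → Fin (suc m) → ℕ
      hᴿ r s = ∑ λ c → ∑ λ d → Iᴿ (r , c) (s , d)
      hᴬ r s = ∑ λ c → ∑ λ d → Iᴬ (r , c) (s , d)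

    sum-zcountᴿ : sum (map zcountᴿ (cells μ)) ≡ ∑ λ r → ∑ λ x → ∑ λ c → ⟦ rowBetween? r x c ⟧
    sum-zcountᴿ = ≡.trans (sum-map-cells μ zcountᴿ) (sum-cong-≗ λ r →
      ≡.trans (sum-cong-≗ λ c → count≡∑ (λ x → R? (toℕ x) (toℕ c) ×-dec between? F (r , c) (r , x)))
        (∑-comm λ c x → ⟦ rowBetween? r x c ⟧))

    rowBetween-∞ : ∀ r x c → entryBelow F (r , x) ≡ nothing → ⟦ rowBetween? r x c ⟧ ≡ ⟦ rowInversion? r x c ⟧
    rowBetween-∞ r x c ≡∞ = ⟦⟧-⇔ (λ (xRc , x<c , _) → xRc , x<c) (λ (xRc , x<c) → xRc , between-∞ ≡∞ x<c)
      (rowBetween? r x c) (rowInversion? r x c)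

    -- Since F x < F y for y below x, every v satisfies F x < v or v < F y.
    rowBetween-below : ∀ i y c → let x = inject≤ y (shorter F i) in
      ⟦ rowBetween? (inject₁ i) x c ⟧ + ⟦ rowPair? i y c ⟧ ≡ ⟦ rowInversion? (inject₁ i) x c ⟧ + ⟦ rowInversionAbove? i y c ⟧
    rowBetween-below i y c = ≡.trans
      (⟦⟧-crossing (R? (toℕ x) (toℕ c)) (entry F (inject₁ i , x) Fin.<? v) (<⁺-dec Fin._<?_ (finite v) (entryBelow F (inject₁ i , x)))
        λ x≮c → <⇒<⁺ (ℕ.≤-<-trans (ℕ.≮⇒≥ x≮c) (below-greater i y)))
      (≡.cong₂ _+_ ≡.refl (⟦⟧-⇔
        (λ (xRc , c<y) → ≡.subst (λ j → R j (toℕ c)) toℕ-x xRc , <⁺⇒< c<y)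
        (λ (yRc , c<y) → ≡.subst (λ j → R j (toℕ c)) (≡.sym toℕ-x) yRc , <⇒<⁺ c<y)
        (R? (toℕ x) (toℕ c) ×-dec <⁺-dec Fin._<?_ (finite v) (entryBelow F (inject₁ i , x))) (rowInversionAbove? i y c)))
      where
      x = inject≤ y (shorter F i)
      v = entry F (inject₁ i , c)
      toℕ-x = Fin.toℕ-inject≤ y (shorter F i)

      <⇒<⁺ : v Fin.< entry F (suc i , y) → finite v <⁺ entryBelow F (inject₁ i , x)
      <⇒<⁺ = ≡.subst (finite v <⁺_) (≡.sym (below-inject F i y)) ∘ [_]

      <⁺⇒< : finite v <⁺ entryBelow F (inject₁ i , x) → v Fin.< entry F (suc i , y)
      <⁺⇒< = [<]-injective ∘ ≡.subst (finite v <⁺_) (below-inject F i y)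

    -- Columns `x` that reach the next row are handled by `rowBetween-below`; the remaining ones
    -- have ∞ below them, so `rowBetween-∞` applies.
    row-identity : ∀ i →
      (∑ λ x → ∑ λ c → ⟦ rowBetween? (inject₁ i) x c ⟧) + (∑ λ y → ∑ λ c → ⟦ rowPair? i y c ⟧) ≡
      (∑ λ x → ∑ λ c → ⟦ rowInversion? (inject₁ i) x c ⟧) + (∑ λ y → ∑ λ c → ⟦ rowInversionAbove? i y c ⟧)
    row-identity i = ∑-initial-segment (shorter F i) _ _ _ _
      (λ y → let x = inject≤ y (shorter F i) in ≡.trans
        (≡.sym (∑-distrib-+ (λ c → ⟦ rowBetween? (inject₁ i) x c ⟧) (λ c → ⟦ rowPair? i y c ⟧)))
        (≡.trans (sum-cong-≗ (rowBetween-below i y))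
          (∑-distrib-+ (λ c → ⟦ rowInversion? (inject₁ i) x c ⟧) (λ c → ⟦ rowInversionAbove? i y c ⟧))))
      (λ x μ≤x → sum-cong-≗ λ c → rowBetween-∞ (inject₁ i) x c (entryBelow-short i x μ≤x))

    -- Every row `inject₁ i` is treated together with the row `suc i` beneath it by `row-identity`.
    -- The last row has ∞ below all its cells, so it contributes exactly its own inversions.
    sum-zcountᴿ+pairs : sum (map zcountᴿ (cells μ)) + (∑ λ i → ∑ λ y → ∑ λ c → ⟦ rowPair? i y c ⟧) ≡ length inversions
    sum-zcountᴿ+pairs = begin
      sum (map zcountᴿ (cells μ)) + ∑ D
        ≡⟨ ≡.cong (_+ ∑ D) (≡.trans sum-zcountᴿ (sum-init-last Z)) ⟩
      (∑ (Z ∘ inject₁) + Z (fromℕ m)) + ∑ D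
        ≡⟨ xy∙z≈xz∙y (∑ (Z ∘ inject₁)) (Z (fromℕ m)) (∑ D) ⟩
      (∑ (Z ∘ inject₁) + ∑ D) + Z (fromℕ m)
        ≡⟨ ≡.cong₂ _+_
             (≡.trans (≡.sym (∑-distrib-+ (Z ∘ inject₁) D)) (≡.trans (sum-cong-≗ row-identity) (∑-distrib-+ (I ∘ inject₁) K)))
             (sum-cong-≗ λ x → sum-cong-≗ λ c → rowBetween-∞ (fromℕ m) x c (entryBelow-last x)) ⟩
      (∑ (I ∘ inject₁) + ∑ K) + I (fromℕ m)
        ≡⟨ xy∙z≈xz∙y (∑ (I ∘ inject₁)) (∑ K) (I (fromℕ m)) ⟩
      (∑ (I ∘ inject₁) + I (fromℕ m)) + ∑ K
        ≡⟨ ≡.cong (_+ ∑ K) (sum-init-last I) ⟨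
      ∑ I + ∑ K
        ≡⟨ length-inversions ⟨
      length inversions ∎
      where
      Z I : Fin (suc m) → ℕ
      Z r = ∑ λ x → ∑ λ c → ⟦ rowBetween? r x c ⟧
      I r = ∑ λ x → ∑ λ c → ⟦ rowInversion? r x c ⟧
      D K : Fin m → ℕ
      D i = ∑ λ y → ∑ λ c → ⟦ rowPair? i y c ⟧
      K i = ∑ λ y → ∑ λ c → ⟦ rowInversionAbove? i y c ⟧

  -- By column strictness the descents are all the cells outside the first row.
  sum-Des : (f : Cell μ → ℕ) → sum (map f (Des F)) ≡ ∑ λ i → ∑ λ y → f (suc i , y)
  sum-Des f = begin
    sum (map f (Des F))
      ≡⟨ sum-map-filter _ f (cells μ) ⟩
    sum (map (λ u → ⟦ des? u ⟧ * f u) (cells μ))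
      ≡⟨ sum-map-cells μ _ ⟩
    (∑ λ r → ∑ λ c → ⟦ des? (r , c) ⟧ * f (r , c))
      ≡⟨ ≡.cong₂ _+_ (∑-zero (λ c → ⟦ des? (zero , c) ⟧ * f (zero , c)) λ c → ≡.cong (_* f (zero , c)) (⟦⟧-no (λ ()) (des? (zero , c))))
           (sum-cong-≗ λ i → sum-cong-≗ λ y → ≡.trans
             (≡.cong (_* f (suc i , y)) (⟦⟧-yes (s≤s z≤n , below-greater i y) (des? (suc i , y))))
             (ℕ.+-identityʳ _)) ⟩
    (∑ λ i → ∑ λ y → f (suc i , y)) ∎
    where
    des? : ∀ u → Dec (0 ℕ.< toℕ (row u) × entry F (above u) Fin.< entry F u)
    des? u = (0 ℕ.<? toℕ (row u)) ×-dec (entry F (above u) Fin.<? entry F u)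

  arm≡∑ : ∀ r (c : Fin (part μ r)) → arm {μ = μ} (r , c) ≡ ∑ λ (d : Fin (part μ r)) → ⟦ toℕ c ℕ.<? toℕ d ⟧
  arm≡∑ r c = begin
    arm {μ = μ} (r , c)
      ≡⟨ ≡.trans (count≡sum right? (cells μ)) (sum-map-cells μ _) ⟩
    (∑ λ s → ∑ λ d → ⟦ right? (s , d) ⟧)
      ≡⟨ ∑-single _ r (λ s s≢r → ∑-zero _ λ d → ⟦⟧-no (s≢r ∘ proj₁) (right? (s , d))) ⟩
    (∑ λ d → ⟦ right? (r , d) ⟧)
      ≡⟨ (sum-cong-≗ λ d → ⟦⟧-⇔ proj₂ (≡.refl ,_) (right? (r , d)) (toℕ c ℕ.<? toℕ d)) ⟩
    (∑ λ (d : Fin (part μ r)) → ⟦ toℕ c ℕ.<? toℕ d ⟧) ∎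
    where
    right? : ∀ v → Dec (row v ≡ r × toℕ c ℕ.< col v)
    right? v = (row v Fin.≟ r) ×-dec (toℕ c ℕ.<? col v)

  sum-zcount : + sum (map (λ c → zcount c F) (cells μ)) ≡ quinv F
  sum-zcount = difference (≡.trans
    (≡.cong₂ _+_ (≡.refl {x = sum (map (λ c → zcount c F) (cells μ))}) (≡.trans (sum-Des (arm ∘ above))
      (sum-cong-≗ λ i → sum-cong-≗ λ y → arm≡∑ (inject₁ i) (inject≤ y (shorter F i)))))
    -- At this relation `zcountᴿ` and `inversions` unfold to `zcount` and `Quinv F`.
    (sum-zcountᴿ+pairs ℕ._<?_))

  sum-zcount-bar : + sum (map (λ c → zcount-bar c F) (cells μ)) ≡ inv F
  sum-zcount-bar = difference (≡.trans
    (≡.cong₂ _+_ (≡.refl {x = sum (map (λ c → zcount-bar c F) (cells μ))}) (≡.trans (sum-Des arm)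
      (sum-cong-≗ λ i → ≡.trans
        (sum-cong-≗ λ y → arm≡∑ (suc i) y)
        -- The arms count pairs `y < d` in the lower row. Grouped by the right-hand cell `d` they
        -- number `toℕ d`, and so do the cells to the left of the one above `d`.
        (≡.trans (∑-comm λ (y d : Fin (part μ (suc i))) → ⟦ toℕ y ℕ.<? toℕ d ⟧) (sum-cong-≗ λ d → ≡.trans
          (∑-<-const (toℕ d) (ℕ.<⇒≤ (Fin.toℕ<n d)))
          (≡.sym (≡.trans
            (sum-cong-≗ λ (c : Fin (part μ (inject₁ i))) →
              ≡.cong (λ j → ⟦ toℕ c ℕ.<? j ⟧) (Fin.toℕ-inject≤ d (shorter F i)))
            (∑-<-const (toℕ d) (ℕ.≤-trans (ℕ.<⇒≤ (Fin.toℕ<n d)) (shorter F i))))))))))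
    (sum-zcountᴿ+pairs (λ i j → j ℕ.<? i)))

  -- The sum of the two zcounts in terms of the row contents.

  rowCount : {P : Pred (Fin (suc m)) p} → Decidable P → Fin (suc m) → ℕ
  rowCount P? r = ∑ λ x → ⟦ P? (entry F (r , x)) ⟧

  count-rsort-rowCount : {P : Pred (Fin (suc m)) p} (P? : Decidable P) → ∀ r → count P? (rsort F r) ≡ rowCount P? r
  count-rsort-rowCount P? r = ≡.trans
    (↭-length (filter-↭ P? (Sort.sort-↭ (Fin.≤-decTotalOrder (suc m)) (tabulate λ c → entry F (r , c)))))
    (≡.trans (count≡sum P? (tabulate λ c → entry F (r , c))) (sum-map-tabulate (⟦_⟧ ∘ P?) λ c → entry F (r , c)))

  betweens : Cell μ → ℕ
  betweens (r , c) = ∑ λ x → ⟦ between? F (r , c) (r , x) ⟧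

  -- Left and right together miss only `x = c`, which is not counted by `betweens` either, since
  -- `F c < F c` fails.
  zcount+zcount-bar : ∀ c → zcount c F + zcount-bar c F ≡ betweens c
  zcount+zcount-bar (r , c) = ≡.trans
    (≡.cong₂ _+_ (count≡∑ (λ x → (x Fin.<? c) ×-dec btw? x)) (count≡∑ (λ x → (c Fin.<? x) ×-dec btw? x)))
    (≡.trans (≡.sym (∑-distrib-+ (λ x → ⟦ (x Fin.<? c) ×-dec btw? x ⟧) (λ x → ⟦ (c Fin.<? x) ×-dec btw? x ⟧)))
      (sum-cong-≗ λ x → ≡.trans
        (≡.sym (⟦⟧-⊎-× (x Fin.<? c) (c Fin.<? x) (btw? x) ℕ.<-asym))
        (⟦⟧-⇔ proj₂ (λ b → left-or-right (proj₁ b) , b) (((x Fin.<? c) ⊎-dec (c Fin.<? x)) ×-dec btw? x) (btw? x))))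
    where
    btw? = λ x → between? F (r , c) (r , x)

    left-or-right : ∀ {x} → entry F (r , x) Fin.< entry F (r , c) → x Fin.< c ⊎ c Fin.< x
    left-or-right {x} x<c with Fin.<-cmp x c
    ... | tri< x<c _ _ = inj₁ x<c
    ... | tri≈ _ ≡.refl _ = contradiction x<c (ℕ.<-irrefl ≡.refl)
    ... | tri> _ _ c<x = inj₂ c<x

  betweens-last : ∀ c → betweens (fromℕ m , c) ≡ rowCount (Fin._<? entry F (fromℕ m , c)) (fromℕ m)
  betweens-last c = sum-cong-≗ λ x →
    ⟦⟧-⇔ proj₁ (between-∞ (entryBelow-last x)) (between? F (fromℕ m , c) (fromℕ m , x))
      (entry F (fromℕ m , x) Fin.<? entry F (fromℕ m , c))

  -- The cells x with F x < F c that are not counted by betweens c are those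
  -- above a cell y with F y ≤ F c.
  betweens-inject₁ : ∀ i c → let v = entry F (inject₁ i , c) in
    betweens (inject₁ i , c) + rowCount (Fin._≤? v) (suc i) ≡ rowCount (Fin._<? v) (inject₁ i)
  betweens-inject₁ i c = ≡.trans
    -- The lower row contributes on the left side only, so its summand on the right is zero.
    (∑-initial-segment (shorter F i) _ _ _ (λ _ → 0)
      (λ y → ≡.trans (split y) (≡.sym (ℕ.+-identityʳ _)))
      (λ x μ≤x → ⟦⟧-⇔ proj₁ (between-∞ (entryBelow-short i x μ≤x)) (between? F (inject₁ i , c) (inject₁ i , x))
        (entry F (inject₁ i , x) Fin.<? v)))
    (≡.trans (≡.cong₂ _+_ ≡.refl (∑-zero {part μ (suc i)} (λ _ → 0) λ _ → ≡.refl)) (ℕ.+-identityʳ _))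
    where
    v = entry F (inject₁ i , c)

    split : ∀ y → let x = inject≤ y (shorter F i) in
      ⟦ between? F (inject₁ i , c) (inject₁ i , x) ⟧ + ⟦ entry F (suc i , y) Fin.≤? v ⟧ ≡
      ⟦ entry F (inject₁ i , x) Fin.<? v ⟧
    split y = ⟦⟧-+ (between? F (inject₁ i , c) (inject₁ i , x)) (entry F (suc i , y) Fin.≤? v)
      (entry F (inject₁ i , x) Fin.<? v)
      (λ (_ , v<y) y≤v → ℕ.<⇒≱ ([<]-injective (≡.subst (finite v <⁺_) (below-inject F i y) v<y)) y≤v)
      proj₁ (λ y≤v → ℕ.<-≤-trans (below-greater i y) y≤v)
      (λ x<v y≰v → x<v , ≡.subst (finite v <⁺_) (≡.sym (below-inject F i y)) [ ℕ.≰⇒> y≰v ])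
      where
      x = inject≤ y (shorter F i)

-- The sum depends on the row and the letter of a cell, not on its column. Fillings with equal
-- `rsort` may hold different letters at one position, so cells are matched by row and letter.
zcount+zcount-bar-rsort : {μ : Partition (suc m)} (F F′ : CSF μ) → (∀ r → rsort F r ≡ rsort F′ r) →
  (c c′ : Cell μ) → row c ≡ row c′ → entry F c ≡ entry F′ c′ →
  zcount c F + zcount-bar c F ≡ zcount c′ F′ + zcount-bar c′ F′
zcount+zcount-bar-rsort {m} {μ} F F′ rsort≡ (r , c) (.r , c′) ≡.refl entry≡ =
  ≡.trans (zcount+zcount-bar F (r , c)) (≡.trans (lemma r c c′ entry≡) (≡.sym (zcount+zcount-bar F′ (r , c′))))
  where
  open ≡.≡-Reasoning

  rowCount≡ : {P : Pred (Fin (suc m)) p} (P? : Decidable P) → ∀ r → rowCount F P? r ≡ rowCount F′ P? r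
  rowCount≡ P? r = ≡.trans (≡.sym (count-rsort-rowCount F P? r))
    (≡.trans (≡.cong (count P?) (rsort≡ r)) (count-rsort-rowCount F′ P? r))

  lemma : ∀ r c c′ → entry F (r , c) ≡ entry F′ (r , c′) → betweens F (r , c) ≡ betweens F′ (r , c′)
  lemma r c c′ entry≡ with view r
  ... | ‵fromℕ = begin
    betweens F (fromℕ m , c)
      ≡⟨ betweens-last F c ⟩
    rowCount F (Fin._<? entry F (fromℕ m , c)) (fromℕ m)
      ≡⟨ rowCount≡ (Fin._<? entry F (fromℕ m , c)) (fromℕ m) ⟩
    rowCount F′ (Fin._<? entry F (fromℕ m , c)) (fromℕ m)
      ≡⟨ ≡.cong (λ v → rowCount F′ (Fin._<? v) (fromℕ m)) entry≡ ⟩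
    rowCount F′ (Fin._<? entry F′ (fromℕ m , c′)) (fromℕ m)
      ≡⟨ betweens-last F′ c′ ⟨
    betweens F′ (fromℕ m , c′) ∎
  -- The lower-row count is the same for both fillings, so it is added to both sides and cancelled.
  ... | ‵inject₁ i = ℕ.+-cancelʳ-≡ _ _ _ (begin
    betweens F (inject₁ i , c) + rowCount F (Fin._≤? v) (suc i)
      ≡⟨ betweens-inject₁ F i c ⟩
    rowCount F (Fin._<? v) (inject₁ i)
      ≡⟨ rowCount≡ (Fin._<? v) (inject₁ i) ⟩
    rowCount F′ (Fin._<? v) (inject₁ i)
      ≡⟨ ≡.cong (λ v → rowCount F′ (Fin._<? v) (inject₁ i)) entry≡ ⟩
    rowCount F′ (Fin._<? v′) (inject₁ i)
      ≡⟨ betweens-inject₁ F′ i c′ ⟨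
    betweens F′ (inject₁ i , c′) + rowCount F′ (Fin._≤? v′) (suc i)
      ≡⟨ ≡.cong₂ _+_ ≡.refl (≡.cong (λ v → rowCount F′ (Fin._≤? v) (suc i)) entry≡) ⟨
    betweens F′ (inject₁ i , c′) + rowCount F′ (Fin._≤? v) (suc i)
      ≡⟨ ≡.cong₂ _+_ ≡.refl (rowCount≡ (Fin._≤? v) (suc i)) ⟨
    betweens F′ (inject₁ i , c′) + rowCount F (Fin._≤? v) (suc i) ∎)
    where
    v = entry F (inject₁ i , c)
    v′ = entry F′ (inject₁ i , c′)

-- Products of sorted lists in a monoid.

AllPairs-remove : {R : Rel A p} (us : List A) {x : A} {vs : List A} → AllPairs R (us ++ x ∷ vs) →
  All (λ u → R u x) us × AllPairs R (us ++ vs)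
AllPairs-remove [] (_ ∷ vs↗) = [] , vs↗
AllPairs-remove (u ∷ us) (u≼ ∷ us↗) with AllPairs-remove us us↗ | All.++⁻ us u≼
... | us≼x , us+vs↗ | u≼us , u≼x ∷ u≼vs = (u≼x ∷ us≼x) , (All.++⁺ u≼us u≼vs ∷ us+vs↗)

All⇒AllPairs : ∀ {P : A → Set p} {R : Rel A q} → (∀ {x y} → P x → P y → R x y) →
  ∀ {xs} → All P xs → AllPairs R xs
All⇒AllPairs R [] = []
All⇒AllPairs R (px ∷ pxs) = All.map (R px) pxs ∷ All⇒AllPairs R pxs

All-All-∈ : ∀ {R : A → B → Set p} {xs ys} → (∀ {x y} → x ∈ xs → y ∈ ys → R x y) → All (λ x → All (R x) ys) xs
All-All-∈ R = All.tabulate λ x∈ → All.tabulate λ y∈ → R x∈ y∈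

module _ (M : Monoid a ℓ) where

  open Monoid M

  product : List Carrier → Carrier
  product = foldr _∙_ ε

  product-++ : (xs ys : List Carrier) → product (xs ++ ys) ≈ product xs ∙ product ys
  product-++ [] ys = sym (identityˡ _)
  product-++ (x ∷ xs) ys = trans (∙-congˡ (product-++ xs ys)) (sym (assoc _ _ _))

  product-map-cong : {f g : B → Carrier} → (∀ x → f x ≈ g x) → ∀ xs → product (map f xs) ≈ product (map g xs)
  product-map-cong f≈g [] = refl
  product-map-cong f≈g (x ∷ xs) = ∙-cong (f≈g x) (product-map-cong f≈g xs)

  product-concatMap : (f : C → Carrier) (g : B → List C) (xs : List B) →
    product (map f (concatMap g xs)) ≈ product (map (λ x → product (map f (g x))) xs)
  product-concatMap f g [] = refl
  product-concatMap f g (x ∷ xs) = trans (reflexive (≡.cong product (List.map-++ f (g x) (concatMap g xs))))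
    (trans (product-++ (map f (g x)) _) (∙-congˡ (product-concatMap f g xs)))

  module _ (f : B → Carrier) {_≼_ : Rel B p}
    (commute : ∀ {x y} → x ≼ y → y ≼ x → f x ∙ f y ≈ f y ∙ f x) where

    pull-out : ∀ {x} us vs → All (λ u → f u ∙ f x ≈ f x ∙ f u) us →
      product (map f (us ++ x ∷ vs)) ≈ f x ∙ product (map f (us ++ vs))
    pull-out [] vs [] = refl
    pull-out (u ∷ us) vs (ux≈xu ∷ us-commute) = trans (∙-congˡ (pull-out us vs us-commute))
      (trans (sym (assoc _ _ _)) (trans (∙-congʳ ux≈xu) (assoc _ _ _)))

    -- The head `x` of `xs` is moved to the front of `ys`. Any `u` before it in `ys` satisfies
    -- `u ≼ x`, as `ys` is sorted, and `x ≼ u`, as `u` also occurs in the tail of `xs`; hence `f u`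
    -- and `f x` commute.
    sorted-product : ∀ xs {ys} → AllPairs _≼_ xs → AllPairs _≼_ ys → xs ↭ ys →
      product (map f xs) ≈ product (map f ys)
    sorted-product [] xs↗ ys↗ p with ≡.refl ← ↭-empty-inv (↭-sym p) = refl
    sorted-product (x ∷ xs) (x≼xs ∷ xs↗) ys↗ p
      with us , vs , ≡.refl ← ∈-∃++ (∈-resp-↭ p (here ≡.refl)) =
      let us≼x , us+vs↗ = AllPairs-remove us ys↗
          xs↭us+vs = drop-mid [] us p
          x≼us = All.++⁻ˡ us (All-resp-↭ xs↭us+vs x≼xs)
      in trans (∙-congˡ (sorted-product xs xs↗ us+vs↗ xs↭us+vs))
        (sym (pull-out us vs (All.zipWith (λ (u≼x , x≼u) → commute u≼x x≼u) (us≼x , x≼us))))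

-- Commuting generators of the enveloping algebra.

module _ (K : CommutativeRing a ℓ) {c ℓᶜ} (𝔤 : LieAlgebra K c ℓᶜ) where

  open CommutativeRing K using (0#; 1#)
  open LieAlgebra 𝔤
  open Enveloping K 𝔤
  open Ring 𝔘 using (zeroˡ; +-group)
  open GroupProperties +-group using (x∙y⁻¹≈ε⇒x≈y)

  ι-0 : ι 0ᴹ ≈ᵘ scalar 0#
  ι-0 = transᵘ (ι-cong (≈ᴹ-sym (*ₗ-zeroˡ 0ᴹ))) (transᵘ (ι-*ₗ 0# 0ᴹ) (zeroˡ _))

  ι-commute : ∀ x y → ⁅ x , y ⁆ ≈ᴹ 0ᴹ → ι x *ᵘ ι y ≈ᵘ ι y *ᵘ ι x
  ι-commute x y ⁅xy⁆≈0 = x∙y⁻¹≈ε⇒x≈y _ _ (transᵘ (symᵘ (ι-⁅⁆ x y)) (transᵘ (ι-cong ⁅xy⁆≈0) ι-0))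

module _ (K : CommutativeRing a ℓ) where

  open CommutativeRing K renaming (_*_ to _*ᴷ_)
  open CommutativeMonoidSum +-commutativeMonoid using (sum-cong-≋) renaming (sum-replicate-zero to ∑-0#)

  elementary-row : ∀ (p q r s : Fin n) → r ≢ p → elementary K p q r s ≈ 0#
  elementary-row p q r s r≢p with r Fin.≟ p
  ... | yes r≡p = contradiction r≡p r≢p
  ... | no _ = refl

  elementary-column : ∀ (p q r s : Fin n) → s ≢ q → elementary K p q r s ≈ 0#
  elementary-column p q r s s≢q with r Fin.≟ p | s Fin.≟ q
  ... | yes _ | yes s≡q = contradiction s≡q s≢q
  ... | yes _ | no _ = refl
  ... | no _ | _ = refl

  -- In the sum over `k` the first factor vanishes unless `k = q`, and the second unless `k = p′`.
  elementary-· : ∀ (p q p′ q′ : Fin n) → q ≢ p′ → ∀ i j → _·_ K (elementary K p q) (elementary K p′ q′) i j ≈ 0#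
  elementary-· {n} p q p′ q′ q≢p′ i j = trans (sum-cong-≋ vanish) (∑-0# n)
    where
    vanish : ∀ k → elementary K p q i k *ᴷ elementary K p′ q′ k j ≈ 0#
    vanish k = vanish′ (k Fin.≟ q)
      where
      vanish′ : Dec (k ≡ q) → elementary K p q i k *ᴷ elementary K p′ q′ k j ≈ 0#
      vanish′ (yes ≡.refl) = trans (*-congˡ (elementary-row p′ q′ k j q≢p′)) (zeroʳ _)
      vanish′ (no k≢q) = trans (*-congʳ (elementary-column p q i k k≢q)) (zeroˡ _)

  module _ {n : ℕ} where

    open Enveloping K (𝔫⁻[t] K n)
    open Current K (𝔫⁻ K n) using (_⊗_; ⊗-cong; 0⊗; transᶜ)

    -- The bracket is a matrix commutator tensored with `f *ᵖ g`, and both matrix products in it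
    -- vanish because `q` and `q′` differ from `p`.
    E-commute : ∀ {p p′ q q′ : Fin n} → p ≡ p′ → .(q<p : q Fin.< p) .(q′<p′ : q′ Fin.< p′) → ∀ f g →
      ι (E K p q q<p ⊗ f) *ᵘ ι (E K p′ q′ q′<p′ ⊗ g) ≈ᵘ ι (E K p′ q′ q′<p′ ⊗ g) *ᵘ ι (E K p q q<p ⊗ f)
    E-commute {p} {.p} {q} {q′} ≡.refl q<p q′<p f g = ι-commute K (𝔫⁻[t] K n) _ _
      (transᶜ (⊗-cong (λ i j → 0-0≈0 K
        (elementary-· p q p q′ (λ { ≡.refl → contradiction-irr q<p (ℕ.<-irrefl ≡.refl) }) i j)
        (elementary-· p q′ p q (λ { ≡.refl → contradiction-irr q′<p (ℕ.<-irrefl ≡.refl) }) i j)) reflᵖ) (0⊗ _))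

-- The cells listed in the order of the Chari-Loktev monomial.

≤⇒inject! : (j : Fin m) (r : Fin (suc m)) → r Fin.≤ j → ∃ λ (i : Fin′ (suc j)) → r ≡ inject₁ (inject! i)
≤⇒inject! zero zero _ = zero , ≡.refl
≤⇒inject! (suc j) zero _ = zero , ≡.refl
≤⇒inject! (suc j) (suc r) (s≤s r≤j) with i , r≡i ← ≤⇒inject! j r r≤j = suc i , ≡.cong suc r≡i

module _ {μ : Partition n} where

  cells-unique : AllPairs _≢_ (cells μ)
  cells-unique = AllPairs.concat⁺
    (All.map⁺ (All.tabulate⁺ λ r → AllPairs.map⁺ (AllPairs.tabulate⁺ λ i≢j → λ { ≡.refl → i≢j ≡.refl })))
    (AllPairs.map⁺ (AllPairs.tabulate⁺ λ r≢s →
      All.map⁺ (All.universal (λ _ → All.map⁺ (All.universal (λ _ rc≡sd → r≢s (≡.cong row rc≡sd)) _)) _)))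

  ∈-cells : (u : Cell μ) → u ∈ cells μ
  ∈-cells (r , c) = ∈-concat⁺′ (∈-map⁺ (r ,_) (∈-allFin c))
    (∈-map⁺ (λ r → map (r ,_) (allFin (part μ r))) (∈-allFin r))

-- The order inside each block is left open, so that the right-to-left reading of `ψ-quinv` and the
-- left-to-right reading of `ψ-inv` are treated at once.
module _ {μ : Partition (suc m)} (F : CSF μ)
  (block : (i j : Fin m) → List (Fin (part μ (inject₁ i))))
  (block↭ : ∀ i j → block i j ↭ cellsWith F i j) where

  blockCells : (i j : Fin m) → List (Cell μ)
  blockCells i j = map (inject₁ i ,_) (block i j)

  layer : Fin m → List (Cell μ)
  layer j = concatMap (λ (i : Fin′ (suc j)) → blockCells (inject! i) j) (allFin (suc (toℕ j)))

  enumeration-CL : List (Cell μ)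
  enumeration-CL = concatMap layer (allFin m)

  block-entries : ∀ i j → All (λ c → entry F (inject₁ i , c) ≡ suc j) (block i j)
  block-entries i j = All-resp-↭ (↭-sym (block↭ i j)) (cellsWith-entries F i j)

  ∈-block⁻ : ∀ {i j u} → u ∈ blockCells i j → row u ≡ inject₁ i × entry F u ≡ suc j
  ∈-block⁻ {i} {j} u∈ with c , c∈ , ≡.refl ← ∈-map⁻ (inject₁ i ,_) u∈ =
    ≡.refl , All.lookup (block-entries i j) c∈

  ∈-block⁺ : ∀ {i j u} → row u ≡ inject₁ i → entry F u ≡ suc j → u ∈ blockCells i j
  ∈-block⁺ {i} {j} {.(inject₁ i) , c} ≡.refl entry≡ = ∈-map⁺ (inject₁ i ,_)
    (∈-resp-↭ (↭-sym (block↭ i j)) (∈-filter⁺ (λ c → entry F (inject₁ i , c) Fin.≟ suc j) (∈-allFin c) entry≡))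

  ∈-layer⁻ : ∀ {j u} → u ∈ layer j → row u Fin.< entry F u × entry F u ≡ suc j
  ∈-layer⁻ {j} {u} u∈
    with _ , u∈block , block∈ ← ∈-concat⁻′ (map (λ i → blockCells (inject! i) j) (allFin (suc (toℕ j)))) u∈
    with i , _ , ≡.refl ← ∈-map⁻ (λ (i : Fin′ (suc j)) → blockCells (inject! i) j) block∈
    with row≡ , entry≡ ← ∈-block⁻ u∈block
    = ≡.subst₂ Fin._<_ (≡.sym row≡) (≡.sym entry≡) (Fin.≤̄⇒inject₁< (s≤s⁻¹ (Fin.inject!-< i))) , entry≡

  ∈-layer⁺ : ∀ {j u} → row u Fin.< entry F u → entry F u ≡ suc j → u ∈ layer j
  ∈-layer⁺ {j} {u} row<entry entry≡
    with i , row≡ ← ≤⇒inject! j (row u) (s≤s⁻¹ (≡.subst (row u Fin.<_) entry≡ row<entry))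
    = ∈-concat⁺′ (∈-block⁺ row≡ entry≡) (∈-map⁺ (λ i → blockCells (inject! i) j) (∈-allFin i))

  ∈-enumeration⁻ : ∀ {u} → u ∈ enumeration-CL → row u Fin.< entry F u
  ∈-enumeration⁻ u∈
    with _ , u∈layer , layer∈ ← ∈-concat⁻′ (map layer (allFin m)) u∈
    with j , _ , ≡.refl ← ∈-map⁻ layer layer∈
    = proj₁ (∈-layer⁻ u∈layer)

  ∈-enumeration⁺ : ∀ {u} → row u Fin.< entry F u → u ∈ enumeration-CL
  ∈-enumeration⁺ {u} row<entry with entry F u in entry≡
  -- The letter `zero` exceeds no row number, so only this case is left.
  ... | suc j = ∈-concat⁺′
    (∈-layer⁺ (≡.subst (row u Fin.<_) (≡.sym entry≡) row<entry) entry≡) (∈-map⁺ layer (∈-allFin j))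

  _≼_ : Rel (Cell μ) _
  u ≼ v = entry F u Fin.≤ entry F v

  block-unique : ∀ i j → AllPairs _≢_ (blockCells i j)
  block-unique i j = AllPairs.map⁺ (AllPairs.map (λ c≢d → λ { ≡.refl → c≢d ≡.refl })
    (Unique-resp-↭ (≡.setoid _) (↭⇒↭ₛ (↭-sym (block↭ i j)))
      (AllPairs.filter⁺ (λ c → entry F (inject₁ i , c) Fin.≟ suc j) (AllPairs.tabulate⁺ id))))

  layer-unique : ∀ j → AllPairs _≢_ (layer j)
  layer-unique j = AllPairs.concat⁺
    (All.map⁺ (All.tabulate⁺ λ (i : Fin′ (suc j)) → block-unique (inject! i) j))
    (AllPairs.map⁺ (AllPairs.tabulate⁺ λ {i i′ : Fin′ (suc j)} i≢i′ → All-All-∈ λ {u∈ v∈ ≡.refl → i≢i′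
      (Fin.inject!-injective (Fin.inject₁-injective (≡.trans
        (≡.sym (proj₁ (∈-block⁻ {inject! i} u∈))) (proj₁ (∈-block⁻ {inject! i′} v∈)))))}))

  enumeration-unique : AllPairs _≢_ enumeration-CL
  enumeration-unique = AllPairs.concat⁺
    (All.map⁺ (All.tabulate⁺ layer-unique))
    (AllPairs.map⁺ (AllPairs.tabulate⁺ λ j≢j′ → All-All-∈ λ {u∈ v∈ ≡.refl → j≢j′
      (Fin.suc-injective (≡.trans (≡.sym (proj₂ (∈-layer⁻ u∈))) (proj₂ (∈-layer⁻ v∈))))}))

  -- All entries of `layer j` equal `suc j`, and the layers come in increasing order of `j`.
  enumeration-increasing : AllPairs _≼_ enumeration-CL
  enumeration-increasing = AllPairs.concat⁺
    (All.map⁺ (All.tabulate⁺ λ j → All⇒AllPairs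
      (λ u≡ v≡ → ℕ.≤-reflexive (≡.cong toℕ (≡.trans u≡ (≡.sym v≡)))) (All.tabulate (proj₂ ∘ ∈-layer⁻ {j}))))
    (AllPairs.map⁺ (AllPairs.tabulate⁺-< λ j<j′ → All-All-∈ λ u∈ v∈ →
      ≡.subst₂ Fin._≤_ (≡.sym (proj₂ (∈-layer⁻ u∈))) (≡.sym (proj₂ (∈-layer⁻ v∈))) (s≤s (ℕ.<⇒≤ j<j′))))

  -- Both lists are free of repetitions and have the same members.
  enumeration↭ : enumeration-CL ↭ filter (λ c → row c Fin.<? entry F c) (cells μ)
  enumeration↭ = ∼bag⇒↭ (unique∧set⇒bag enumeration-unique
    (AllPairs.filter⁺ (λ c → row c Fin.<? entry F c) cells-unique)
    (mk⇔ (λ u∈ → ∈-filter⁺ (λ c → row c Fin.<? entry F c) (∈-cells _) (∈-enumeration⁻ u∈))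
      (λ u∈ → ∈-enumeration⁺ (proj₂ (∈-filter⁻ (λ c → row c Fin.<? entry F c) {xs = cells μ} u∈)))))

-- Chari-Loktev monomials as ordered products over cells.

module _ (K : CommutativeRing a ℓ) {μ : Partition (suc m)} (F : CSF μ) (z : Cell μ → ℕ) where

  open CommutativeRing K using (1#)
  open Enveloping K (𝔫⁻[t] K (suc m))
  open Current K (𝔫⁻ K (suc m)) using (_⊗_)
  open Ring (𝔘𝔫⁻[t] K (suc m)) using (reflexive; *-monoid; setoid)

  factor : (u : Cell μ) → .(row u Fin.< entry F u) → Term
  factor u u< = ι (E K (entry F u) (row u) u< ⊗ t^_ K (z u))

  -- Extends `factor` to all cells, so that products can be taken over plain lists of cells without
  -- proofs attached. The default `scalar 1#` never occurs in the enumerations used.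
  generator : Cell μ → Term
  generator u with row u Fin.<? entry F u
  ... | yes u< = factor u u<
  ... | no _ = scalar 1#

  generator-factor : ∀ u .(u< : row u Fin.< entry F u) → generator u ≡ factor u u<
  generator-factor u u< with row u Fin.<? entry F u
  ... | yes _ = ≡.refl
  ... | no u≮ = contradiction-irr u< u≮

  generator-commute : ∀ {u v} → entry F u ≡ entry F v → generator u *ᵘ generator v ≈ᵘ generator v *ᵘ generator u
  generator-commute {u} {v} u≡v with row u Fin.<? entry F u | row v Fin.<? entry F v
  ... | yes u< | yes v< = E-commute K u≡v u< v< _ _
  ... | yes _ | no _ = symᵘ (scalar-central _ _)
  ... | no _ | _ = scalar-central _ _

  reduce-generator : ∀ {us} (us< : All (λ u → row u Fin.< entry F u) us) →
    All.reduce (λ {u} u< → factor u u<) us< ≡ map generator us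
  reduce-generator [] = ≡.refl
  reduce-generator (u< ∷ us<) = ≡.cong₂ _∷_ (≡.sym (generator-factor _ u<)) (reduce-generator us<)

  -- Flattening the nested products of `CL` gives the product over `enumeration-CL`. This list and
  -- `e` are both increasing and permute the same cells, so `sorted-product` compares them.
  CL-orderedProduct : (P : POP μ) (block : (i j : Fin m) → List (Fin (part μ (inject₁ i)))) →
    (∀ i j → block i j ↭ cellsWith F i j) →
    (∀ i j .(i≤j : i Fin.≤ j) → parts (Λ P i j i≤j) ≡ map (λ c → z (inject₁ i , c)) (block i j)) →
    (e : IncreasingEnumeration F) → CL K P ≈ᵘ orderedProduct K z e
  CL-orderedProduct P block block↭ parts≡ e = begin
    ∏ (map (𝕃ⱼ K P) (allFin m))
      ≈⟨ product-map-cong *-monoid (λ j → begin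
           _ ≈⟨ product-map-cong *-monoid (λ (i : Fin′ (suc j)) → reflexive (𝕃ᵢⱼ-generator (inject! i) j _)) (allFin (suc (toℕ j))) ⟩
           _ ≈⟨ product-concatMap *-monoid generator (λ i → blockCells F block block↭ (inject! i) j) (allFin (suc (toℕ j))) ⟨
           ∏ (map generator (layer F block block↭ j)) ∎) (allFin m) ⟩
    ∏ (map (λ j → ∏ (map generator (layer F block block↭ j))) (allFin m))
      ≈⟨ product-concatMap *-monoid generator (layer F block block↭) (allFin m) ⟨
    ∏ (map generator (enumeration-CL F block block↭))
      -- Cells related both ways by `≼` carry the same letter, which is what `generator-commute`
      -- requires.
      ≈⟨ sorted-product *-monoid generator (λ u≤v v≤u → generator-commute (Fin.≤-antisym u≤v v≤u)) _
           (enumeration-increasing F block block↭) (increasing e)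
           (↭-trans (enumeration↭ F block block↭) (↭-sym (permutes e))) ⟩
    ∏ (map generator (enumeration e))
      ≡⟨ ≡.cong ∏ (reduce-generator (row<entry e)) ⟨
    orderedProduct K z e ∎
    where
    open SetoidReasoning setoid

    factor-generator : ∀ i j .(i≤j : i Fin.≤ j) {c} → entry F (inject₁ i , c) ≡ suc j →
      ι (E K (suc j) (inject₁ i) (Fin.≤̄⇒inject₁< i≤j) ⊗ t^_ K (z (inject₁ i , c))) ≡ generator (inject₁ i , c)
    factor-generator i j i≤j {c} entry≡ = ≡.trans (E-cong (≡.sym entry≡) _ _) (≡.sym (generator-factor (inject₁ i , c)
      (≡.subst (inject₁ i Fin.<_) (≡.sym entry≡) (Fin.≤̄⇒inject₁< i≤j))))
      where
      E-cong : ∀ {p p′ q f} → p ≡ p′ → .(q<p : q Fin.< p) .(q<p′ : q Fin.< p′) → ι (E K p q q<p ⊗ f) ≡ ι (E K p′ q q<p′ ⊗ f)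
      E-cong ≡.refl _ _ = ≡.refl

    𝕃ᵢⱼ-generator : ∀ i j .(i≤j : i Fin.≤ j) → 𝕃ᵢⱼ K P i j i≤j ≡ ∏ (map generator (blockCells F block block↭ i j))
    𝕃ᵢⱼ-generator i j i≤j = ≡.cong ∏ (≡.trans (≡.cong (map _) (parts≡ i j i≤j))
      (≡.trans (≡.sym (List.map-∘ (block i j)))
        (≡.trans (List.map-cong-local (All.map (factor-generator i j i≤j) (block-entries F block block↭ i j)))
          (List.map-∘ (block i j)))))

proposition2 : ∀ {a ℓ} (K : CommutativeRing a ℓ) {m} (μ : Partition (suc m)) →
  ((F : CSF μ) →
    (+ sum (map (λ c → zcount c F) (cells μ)) ≡ quinv F) ×
    (+ sum (map (λ c → zcount-bar c F) (cells μ)) ≡ inv F)) ×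
  ((F F′ : CSF μ) → (∀ r → rsort F r ≡ rsort F′ r) →
    (c c′ : Cell μ) → row c ≡ row c′ → entry F c ≡ entry F′ c′ →
    zcount c F + zcount-bar c F ≡ zcount c′ F′ + zcount-bar c′ F′) ×
  ((F : CSF μ) (e : IncreasingEnumeration F) →
    let open Ring (𝔘𝔫⁻[t] K (suc m)) using (_≈_) in
    (𝔟-quinv K F ≈ orderedProduct K (λ c → zcount c F) e) ×
    (𝔟-inv K F ≈ orderedProduct K (λ c → zcount-bar c F) e))
proposition2 K {m} μ =
  (λ F → sum-zcount F , sum-zcount-bar F) ,
  zcount+zcount-bar-rsort ,
  λ F e →
    -- The blocks follow the reading orders in `ψ-quinv` and `ψ-inv`, so the parts agree by `refl`.
    CL-orderedProduct K F (λ c → zcount c F) (ψ-quinv F) (λ i j → reverse (cellsWith F i j))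
      (λ i j → ↭-reverse (cellsWith F i j)) (λ _ _ _ → ≡.refl) e ,
    CL-orderedProduct K F (λ c → zcount-bar c F) (ψ-inv F) (cellsWith F)
      (λ _ _ → ↭-refl) (λ _ _ _ → ≡.refl) e
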